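{- Let $G=(V,E)$ be a simple finite graph on $m$ vertices $v_1,\ldots,v_m$, and let $\mathbf{f}=(f_1,\ldots,f_m)\in\mathbb{N}^m$ be an ordered $m$-tuple of distinct positive integers. Let $\Lambda_{\mathbf{f}}=\Delta_{\mathbf{f}}-\Psi$ be the associated $\mathbf{f}$-labeled zeon combinatorial Laplacian of $G$. Then, for each $\ell=1,\ldots,m$, $\Lambda_{\mathbf{f}}$ has a spectrally simple eigenvalue $\lambda_\ell$ satisfying $$\lambda_\ell=f_\ell+\sum_{I\subseteq[m]}\omega_I\,\zeta_I\prod_{j\in I\setminus\{\ell\}}(f_\ell-f_j)^{ -1},$$ where $(-1)^{|I|}\omega_I$ is the number of cycles based at $v_\ell$ on vertices indexed by $I$.
   Context: Zeon algebra: $\mathbb{C}\mathfrak{Z}$ is the commutative unital complex algebra generated by $\zeta_{\{i\}}$, $i\in\mathbb{N}=\{1,2,\ldots\}$, and the scalar $1=\zeta_\varnothing$, with $\zeta_{\{i\}}\zeta_{\{j\}}=\zeta_{\{j\}}\zeta_{\{i\}}=\zeta_{\{i,j\}}$ for $i\neq j$ and $\zeta_{\{i\}}^2=0$. For finite $I\subset\mathbb{N}$, $\zeta_I=\prod_{i\in I}\zeta_{\{i\}}$; the $\zeta_I$ form a vector space basis. For $u=\sum_I u_I\zeta_I$, the scalar part is $\mathfrak{C}u=u_\varnothing$. Eigenvalues: for $A\in\mathrm{Mat}(m,\mathbb{C}\mathfrak{Z})$, $\lambda\in\mathbb{C}\mathfrak{Z}$ is an eigenvalue if $A\xi=\lambda\xi$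 for some non-null $\xi\in\mathbb{C}\mathfrak{Z}^m$ (non-null: $\mathfrak{C}(\overline{\xi}^{\intercal}\xi)\ne 0$, where the bar is complex conjugation of coefficients; equivalently some component of $\xi$ has nonzero scalar part). The characteristic polynomial is $\chi_A(t)=\det(t\mathbb{I}-A)$. An eigenvalue $\lambda$ is spectrally simple if it is a simple zero of $\chi_A$ (i.e. $\chi_A(u)=(u-\lambda)g(u)$ with $g(\lambda)\neq 0$ for a polynomial $g$ over $\mathbb{C}\mathfrak{Z}$) and $\mathfrak{C}\lambda$ is a simple zero of the complex polynomial obtained by taking scalar parts of the coefficients of $\chi_A$. Graphs: $[m]=\{1,\ldots,m\}$. The nilpotent adjacency matrix $\Psi=(\psi_{ij})$ of $G$ has $\psi_{ij}=\zeta_{\{j\}}$ if $\{v_i,v_j\}\in E$ and $\psi_{ij}=0$ otherwise. $\Delta_{\mathbf{f}}$ is the $m\times m$ diagonal matrix with main diagonal $\mathbf{f}$. Cycles: a $k$-cycle based at $v$ is a sequence of vertices $(w_0,w_1,\ldots,w_k)$ with $w_0=w_k=v$, consecutive vertices adjacent, and $w_0,\ldots,w_{k-1}$ distinct. Cycles are counted as sequences, so 2-cycles $(v,w,v)$ along an edge are counted and the two orientations of a longer cycle are counted separately. The cycle is on vertices indexed by $I$ if $\{w_0,\ldots,w_{k-1}\}=\{v_i:i\in I\}$. -}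

module Defs where

open import Algebra.Bundles using (RawRing; CommutativeRing)
open import Data.Fin using (Fin; zero; suc; toℕ; fromℕ; inject₁; punchIn)
import Data.Fin as Fin
import Data.Fin.Properties as Fin
open import Data.Fin.Subset using (Subset; inside; outside; _∈_; ∣_∣)
import Data.Fin.Subset as Subset
open import Data.Fin.Subset.Properties using (_∈?_)
open import Data.Integer using (ℤ; +_)
import Data.Integer as ℤ
import Data.Integer.Properties as ℤ
open import Data.List using (List; []; _∷_; length; map)
import Data.List.Membership.Propositional as List
open import Data.List.Relation.Unary.Unique.Propositional using (Unique)
open import Data.Nat as ℕ using (ℕ; zero; suc)
import Data.Nat.Properties as ℕ
open import Data.Product using (Σ; ∃; _×_; _,_; proj₁; proj₂)
open import Data.Rational as ℚ using (ℚ; 0ℚ; 1ℚ; ½)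
import Data.Rational.Properties as ℚ
open import Data.Rational.Unnormalised using (mkℚᵘ; *≡*)
open import Data.Rational.Solver using (module +-*-Solver)
open import Data.Vec using (Vec; lookup; []; _∷_; there)
open import Data.Vec.Functional using (Vector)
open import Function using (_∘_; _⇔_)
open import Function.Definitions using (Injective)
open import Level using (0ℓ)
open import Relation.Binary using (Rel; Decidable; Symmetric; Irreflexive)
open import Relation.Binary.PropositionalEquality
  using (_≡_; _≢_; refl; sym; trans; cong; subst)
open import Relation.Nullary using (¬_; yes; no)

import Algebra.Definitions.RawSemiring as RawSemiringDefs

-- s m - t n → 0 as m and n tend independently to infinity.  With s = t
-- this is the Cauchy condition; for Cauchy sequences s and t it says
-- that they have the same limit.
Together : Rel (ℕ → ℚ) 0ℓ
Together s t = ∀ ε → 0ℚ ℚ.< ε →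
  ∃ λ N → ∀ m n → N ℕ.≤ m → N ℕ.≤ n → ℚ.∣ s m ℚ.- t n ∣ ℚ.< ε

record ℝ : Set where
  no-eta-equality
  field
    seq    : ℕ → ℚ
    cauchy : Together seq seq

open ℝ public

infix 4 _≈ʳ_

record _≈ʳ_ (x y : ℝ) : Set where
  no-eta-equality
  constructor mk≈
  field
    together : Together (seq x) (seq y)

open _≈ʳ_ public

private
  module ℚ-Identities where
    open +-*-Solver

    abstract
      neg-minus : ∀ a b → ℚ.- (a ℚ.- b) ≡ b ℚ.- a
      neg-minus = solve 2 (λ a b → :- (a :- b) := b :- a) refl

      neg-minus-neg : ∀ a b → ℚ.- (a ℚ.- b) ≡ (ℚ.- a) ℚ.- (ℚ.- b)
      neg-minus-neg = solve 2 (λ a b → :- (a :- b) := (:- a) :- (:- b)) refl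

      minus-plus : ∀ a b → (a ℚ.- b) ℚ.+ b ≡ a
      minus-plus = solve 2 (λ a b → (a :- b) :+ b := a) refl

      telescope : ∀ a b c → a ℚ.- c ≡ (a ℚ.- b) ℚ.+ (b ℚ.- c)
      telescope = solve 3 (λ a b c → a :- c := (a :- b) :+ (b :- c)) refl

      sum-minus-sum : ∀ a b c d →
        (a ℚ.+ c) ℚ.- (b ℚ.+ d) ≡ (a ℚ.- b) ℚ.+ (c ℚ.- d)
      sum-minus-sum =
        solve 4 (λ a b c d → (a :+ c) :- (b :+ d) := (a :- b) :+ (c :- d)) refl

      product-minus-product : ∀ a b c d →
        a ℚ.* c ℚ.- b ℚ.* d ≡ a ℚ.* (c ℚ.- d) ℚ.+ d ℚ.* (a ℚ.- b)
      product-minus-product =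
        solve 4 (λ a b c d → a :* c :- b :* d := a :* (c :- d) :+ d :* (a :- b)) refl

      halves : ∀ ε → ½ ℚ.* ε ℚ.+ ½ ℚ.* ε ≡ ε
      halves = solve 1 (λ e → con ½ :* e :+ con ½ :* e := e) refl

  open ℚ-Identities

  abstract
    *-pos : ∀ C ε → 0ℚ ℚ.< C → 0ℚ ℚ.< ε → 0ℚ ℚ.< C ℚ.* ε
    *-pos C ε C>0 ε>0 = subst (ℚ._< C ℚ.* ε) (ℚ.*-zeroʳ C)
      (ℚ.*-monoʳ-<-pos C {{ℚ.positive C>0}} {0ℚ} {ε} ε>0)

    half-pos : ∀ {ε} → 0ℚ ℚ.< ε → 0ℚ ℚ.< ½ ℚ.* ε
    half-pos {ε} = *-pos ½ ε (ℚ.positive⁻¹ ½)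

    split : ∀ {p q r ε} → r ≡ p ℚ.+ q →
            ℚ.∣ p ∣ ℚ.< ½ ℚ.* ε → ℚ.∣ q ∣ ℚ.< ½ ℚ.* ε → ℚ.∣ r ∣ ℚ.< ε
    split {p} {q} {r} {ε} refl a b =
      ℚ.≤-<-trans (ℚ.∣p+q∣≤∣p∣+∣q∣ p q)
        (subst (ℚ.∣ p ∣ ℚ.+ ℚ.∣ q ∣ ℚ.<_) (halves ε) (ℚ.+-mono-< a b))

    together-sym : ∀ {s t} → Together s t → Together t s
    together-sym {s} {t} h ε ε>0 with h ε ε>0
    ... | N , p = N , λ m n N≤m N≤n →
      subst (ℚ._< ε)
        (trans (sym (ℚ.∣-p∣≡∣p∣ (s n ℚ.- t m)))
               (cong ℚ.∣_∣ (neg-minus (s n) (t m))))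
        (p n m N≤n N≤m)

    together-trans : ∀ {s t u} → Together s t → Together t u → Together s u
    together-trans {s} {t} {u} h k ε ε>0
      with h (½ ℚ.* ε) (half-pos ε>0) | k (½ ℚ.* ε) (half-pos ε>0)
    ... | N , p | M , q = N ℕ.⊔ M , λ m n N≤m N≤n →
      split (telescope (s m) (t (N ℕ.⊔ M)) (u n))
        (p m (N ℕ.⊔ M) (ℕ.m⊔n≤o⇒m≤o N M N≤m) (ℕ.m≤m⊔n N M))
        (q (N ℕ.⊔ M) n (ℕ.m≤n⊔m N M) (ℕ.m⊔n≤o⇒n≤o N M N≤n))

    together-+ : ∀ {s t s′ t′} → Together s t → Together s′ t′ →
                 Together (λ n → s n ℚ.+ s′ n) (λ n → t n ℚ.+ t′ n)
    together-+ {s} {t} {s′} {t′} h k ε ε>0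
      with h (½ ℚ.* ε) (half-pos ε>0) | k (½ ℚ.* ε) (half-pos ε>0)
    ... | N , p | M , q = N ℕ.⊔ M , λ m n N≤m N≤n →
      split (sum-minus-sum (s m) (t n) (s′ m) (t′ n))
        (p m n (ℕ.m⊔n≤o⇒m≤o N M N≤m) (ℕ.m⊔n≤o⇒m≤o N M N≤n))
        (q m n (ℕ.m⊔n≤o⇒n≤o N M N≤m) (ℕ.m⊔n≤o⇒n≤o N M N≤n))

    together-neg : ∀ {s t} → Together s t → Together (ℚ.-_ ∘ s) (ℚ.-_ ∘ t)
    together-neg {s} {t} h ε ε>0 with h ε ε>0
    ... | N , p = N , λ m n N≤m N≤n →
      subst (ℚ._< ε)
        (trans (sym (ℚ.∣-p∣≡∣p∣ (s m ℚ.- t n)))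
               (cong ℚ.∣_∣ (neg-minus-neg (s m) (t n))))
        (p m n N≤m N≤n)

    EventuallyBoundedBy : (ℕ → ℚ) → ℚ → Set
    EventuallyBoundedBy s B = ∃ λ N → ∀ m → N ℕ.≤ m → ℚ.∣ s m ∣ ℚ.≤ B

    bounded : ∀ {s t} → Together s t → ∃ λ B → 0ℚ ℚ.< B × EventuallyBoundedBy s B
    bounded {s} {t} h with h 1ℚ (ℚ.positive⁻¹ 1ℚ)
    ... | N , p =
      1ℚ ℚ.+ ℚ.∣ t N ∣ ,
      ℚ.+-mono-<-≤ (ℚ.positive⁻¹ 1ℚ) (ℚ.0≤∣p∣ (t N)) ,
      N , λ m N≤m → ℚ.≤-trans
        (subst (λ a → ℚ.∣ a ∣ ℚ.≤ ℚ.∣ s m ℚ.- t N ∣ ℚ.+ ℚ.∣ t N ∣)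
          (minus-plus (s m) (t N))
          (ℚ.∣p+q∣≤∣p∣+∣q∣ (s m ℚ.- t N) (t N)))
        (ℚ.+-monoˡ-≤ ℚ.∣ t N ∣ (ℚ.<⇒≤ (p m N N≤m ℕ.≤-refl)))

    Scale : ℚ → ℚ → Set
    Scale B ε = ∃ λ δ → 0ℚ ℚ.< δ ×
      (∀ a d → ℚ.∣ a ∣ ℚ.≤ B → ℚ.∣ d ∣ ℚ.< δ → ℚ.∣ a ℚ.* d ∣ ℚ.< ε)

    reciprocal : ∀ B → 0ℚ ℚ.< B → ∃ λ C → 0ℚ ℚ.< C × B ℚ.* C ≡ 1ℚ
    reciprocal B B>0 =
      ℚ.1/ B , ℚ.positive⁻¹ (ℚ.1/ B) {{ℚ.1/pos⇒pos B}} , ℚ.*-inverseʳ B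
      where
      instance
        B-positive : ℚ.Positive B
        B-positive = ℚ.positive B>0
        B-nonZero : ℚ.NonZero B
        B-nonZero = ℚ.pos⇒nonZero B

    scale : ∀ B → 0ℚ ℚ.< B → ∀ ε → 0ℚ ℚ.< ε → Scale B ε
    scale B B>0 ε ε>0 = rescale (reciprocal B B>0)
      where
      rescale : (∃ λ C → 0ℚ ℚ.< C × B ℚ.* C ≡ 1ℚ) → Scale B ε
      rescale (C , C>0 , BC≡1) = C ℚ.* ε , *-pos C ε C>0 ε>0 , λ a d a≤B d<δ →
        subst (ℚ._< ε) (sym (ℚ.∣p*q∣≡∣p∣*∣q∣ a d))
          (ℚ.≤-<-trans {ℚ.∣ a ∣ ℚ.* ℚ.∣ d ∣} {B ℚ.* ℚ.∣ d ∣} {ε}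
            (ℚ.*-monoʳ-≤-nonNeg ℚ.∣ d ∣ {{ℚ.nonNegative (ℚ.0≤∣p∣ d)}} {ℚ.∣ a ∣} {B} a≤B)
            (subst (B ℚ.* ℚ.∣ d ∣ ℚ.<_) BCε≡ε
              (ℚ.*-monoʳ-<-pos B {{ℚ.positive B>0}} {ℚ.∣ d ∣} {C ℚ.* ε} d<δ)))
        where
        BCε≡ε : B ℚ.* (C ℚ.* ε) ≡ ε
        BCε≡ε = trans (sym (ℚ.*-assoc B C ε))
                  (trans (cong (ℚ._* ε) BC≡1) (ℚ.*-identityˡ ε))

    together-* : ∀ {s t s′ t′} → Together s t → Together s′ t′ →
                 Together (λ n → s n ℚ.* s′ n) (λ n → t n ℚ.* t′ n)
    together-* {s} {t} {s′} {t′} h k ε ε>0 =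
      let (B , B>0 , s≤B)  = bounded {s} {t} h
          (C , C>0 , t′≤C) = bounded {t′} {s′} (together-sym {s′} {t′} k)
      in combine {B} {C} s≤B t′≤C (scale B B>0 (½ ℚ.* ε) (half-pos ε>0))
                          (scale C C>0 (½ ℚ.* ε) (half-pos ε>0))
      where
      Goal : Set
      Goal = ∃ λ N → ∀ m n → N ℕ.≤ m → N ℕ.≤ n →
        ℚ.∣ s m ℚ.* s′ m ℚ.- t n ℚ.* t′ n ∣ ℚ.< ε

      combine : ∀ {B C} → EventuallyBoundedBy s B → EventuallyBoundedBy t′ C →
                Scale B (½ ℚ.* ε) → Scale C (½ ℚ.* ε) → Goal
      combine {B} {C} (N₁ , b) (N₂ , c) (δ , δ>0 , f) (η , η>0 , g) =
        choose (k δ δ>0) (h η η>0)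
        where
        choose : (∃ λ N → ∀ m n → N ℕ.≤ m → N ℕ.≤ n → ℚ.∣ s′ m ℚ.- t′ n ∣ ℚ.< δ) →
                 (∃ λ N → ∀ m n → N ℕ.≤ m → N ℕ.≤ n → ℚ.∣ s m ℚ.- t n ∣ ℚ.< η) → Goal
        choose (N₃ , p) (N₄ , q) = (N₁ ℕ.⊔ N₂) ℕ.⊔ (N₃ ℕ.⊔ N₄) , λ m n N≤m N≤n →
          split (product-minus-product (s m) (t n) (s′ m) (t′ n))
            (f (s m) (s′ m ℚ.- t′ n)
              (b m (l₁ (lˡ N≤m))) (p m n (l₃ (lʳ N≤m)) (l₃ (lʳ N≤n))))
            (g (t′ n) (s m ℚ.- t n)
              (c n (l₂ (lˡ N≤n))) (q m n (l₄ (lʳ N≤m)) (l₄ (lʳ N≤n))))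
          where
          lˡ : ∀ {m} → (N₁ ℕ.⊔ N₂) ℕ.⊔ (N₃ ℕ.⊔ N₄) ℕ.≤ m → N₁ ℕ.⊔ N₂ ℕ.≤ m
          lˡ = ℕ.m⊔n≤o⇒m≤o (N₁ ℕ.⊔ N₂) (N₃ ℕ.⊔ N₄)
          lʳ : ∀ {m} → (N₁ ℕ.⊔ N₂) ℕ.⊔ (N₃ ℕ.⊔ N₄) ℕ.≤ m → N₃ ℕ.⊔ N₄ ℕ.≤ m
          lʳ = ℕ.m⊔n≤o⇒n≤o (N₁ ℕ.⊔ N₂) (N₃ ℕ.⊔ N₄)
          l₁ : ∀ {m} → N₁ ℕ.⊔ N₂ ℕ.≤ m → N₁ ℕ.≤ m
          l₁ = ℕ.m⊔n≤o⇒m≤o N₁ N₂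
          l₂ : ∀ {m} → N₁ ℕ.⊔ N₂ ℕ.≤ m → N₂ ℕ.≤ m
          l₂ = ℕ.m⊔n≤o⇒n≤o N₁ N₂
          l₃ : ∀ {m} → N₃ ℕ.⊔ N₄ ℕ.≤ m → N₃ ℕ.≤ m
          l₃ = ℕ.m⊔n≤o⇒m≤o N₃ N₄
          l₄ : ∀ {m} → N₃ ℕ.⊔ N₄ ℕ.≤ m → N₄ ℕ.≤ m
          l₄ = ℕ.m⊔n≤o⇒n≤o N₃ N₄

    together-const : ∀ q → Together (λ _ → q) (λ _ → q)
    together-const q ε ε>0 = 0 , λ _ _ _ _ →
      subst (ℚ._< ε) (cong ℚ.∣_∣ (sym (ℚ.+-inverseʳ q))) ε>0

fromℚʳ : ℚ → ℝ
fromℚʳ q .seq _  = q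
fromℚʳ q .cauchy = together-const q

infixl 6 _+ʳ_
infixl 7 _*ʳ_
infix  8 -ʳ_

_+ʳ_ _*ʳ_ : ℝ → ℝ → ℝ
(x +ʳ y) .seq n  = seq x n ℚ.+ seq y n
(x +ʳ y) .cauchy = together-+ {seq x} {seq x} {seq y} {seq y} (cauchy x) (cauchy y)
(x *ʳ y) .seq n  = seq x n ℚ.* seq y n
(x *ʳ y) .cauchy = together-* {seq x} {seq x} {seq y} {seq y} (cauchy x) (cauchy y)

-ʳ_ : ℝ → ℝ
(-ʳ x) .seq n  = ℚ.- seq x n
(-ʳ x) .cauchy = together-neg {seq x} {seq x} (cauchy x)

private
  ≈ʳ-sym : ∀ {x y} → x ≈ʳ y → y ≈ʳ x
  ≈ʳ-sym {x} {y} p = mk≈ (together-sym {seq x} {seq y} (together p))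

  ≈ʳ-trans : ∀ {x y z} → x ≈ʳ y → y ≈ʳ z → x ≈ʳ z
  ≈ʳ-trans {x} {y} {z} p q =
    mk≈ (together-trans {seq x} {seq y} {seq z} (together p) (together q))

  +ʳ-cong : ∀ {x y u v} → x ≈ʳ y → u ≈ʳ v → x +ʳ u ≈ʳ y +ʳ v
  +ʳ-cong {x} {y} {u} {v} p q =
    mk≈ (together-+ {seq x} {seq y} {seq u} {seq v} (together p) (together q))

  *ʳ-cong : ∀ {x y u v} → x ≈ʳ y → u ≈ʳ v → x *ʳ u ≈ʳ y *ʳ v
  *ʳ-cong {x} {y} {u} {v} p q =
    mk≈ (together-* {seq x} {seq y} {seq u} {seq v} (together p) (together q))

  -ʳ-cong : ∀ {x y} → x ≈ʳ y → -ʳ x ≈ʳ -ʳ y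
  -ʳ-cong {x} {y} p = mk≈ (together-neg {seq x} {seq y} (together p))

≈ʳ-pointwise : ∀ {x y} → (∀ n → seq x n ≡ seq y n) → x ≈ʳ y
≈ʳ-pointwise {x} {y} e = mk≈ λ ε ε>0 →
  let (N , p) = cauchy x ε ε>0 in
  N , λ m n N≤m N≤n →
    subst (λ a → ℚ.∣ seq x m ℚ.- a ∣ ℚ.< ε) (e n) (p m n N≤m N≤n)

ℝ-ring : CommutativeRing 0ℓ 0ℓ
ℝ-ring = record
  { Carrier = ℝ ; _≈_ = _≈ʳ_ ; _+_ = _+ʳ_ ; _*_ = _*ʳ_ ; -_ = -ʳ_
  ; 0# = fromℚʳ 0ℚ ; 1# = fromℚʳ 1ℚ
  ; isCommutativeRing = record
    { isRing = record
      { +-isAbelianGroup = record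
        { isGroup = record
          { isMonoid = record
            { isSemigroup = record
              { isMagma = record
                { isEquivalence = record
                  { refl  = λ {x} → mk≈ (cauchy x)
                  ; sym   = ≈ʳ-sym
                  ; trans = ≈ʳ-trans
                  }
                ; ∙-cong = +ʳ-cong
                }
              ; assoc = λ x y z → ≈ʳ-pointwise λ n → ℚ.+-assoc (seq x n) (seq y n) (seq z n)
              }
            ; identity = (λ x → ≈ʳ-pointwise λ n → ℚ.+-identityˡ (seq x n))
                       , (λ x → ≈ʳ-pointwise λ n → ℚ.+-identityʳ (seq x n))
            }
          ; inverse = (λ x → ≈ʳ-pointwise λ n → ℚ.+-inverseˡ (seq x n))
                    , (λ x → ≈ʳ-pointwise λ n → ℚ.+-inverseʳ (seq x n))
          ; ⁻¹-cong = -ʳ-cong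
          }
        ; comm = λ x y → ≈ʳ-pointwise λ n → ℚ.+-comm (seq x n) (seq y n)
        }
      ; *-cong = *ʳ-cong
      ; *-assoc = λ x y z → ≈ʳ-pointwise λ n → ℚ.*-assoc (seq x n) (seq y n) (seq z n)
      ; *-identity = (λ x → ≈ʳ-pointwise λ n → ℚ.*-identityˡ (seq x n))
                   , (λ x → ≈ʳ-pointwise λ n → ℚ.*-identityʳ (seq x n))
      ; distrib = (λ x y z → ≈ʳ-pointwise λ n → ℚ.*-distribˡ-+ (seq x n) (seq y n) (seq z n))
                , (λ x y z → ≈ʳ-pointwise λ n → ℚ.*-distribʳ-+ (seq x n) (seq y n) (seq z n))
      }
    ; *-comm = λ x y → ≈ʳ-pointwise λ n → ℚ.*-comm (seq x n) (seq y n)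
    }
  }

record ℂ : Set where
  no-eta-equality
  field
    re im : ℝ

open ℂ public

infix 4 _≈ᶜ_

record _≈ᶜ_ (z w : ℂ) : Set where
  no-eta-equality
  constructor mk≈ᶜ
  field
    re≈ : re z ≈ʳ re w
    im≈ : im z ≈ʳ im w

open _≈ᶜ_ public

fromℚᶜ : ℚ → ℂ
re (fromℚᶜ q) = fromℚʳ q
im (fromℚᶜ q) = fromℚʳ 0ℚ

infixl 6 _+ᶜ_
infixl 7 _*ᶜ_
infix  8 -ᶜ_

_+ᶜ_ _*ᶜ_ : ℂ → ℂ → ℂ
re (z +ᶜ w) = re z +ʳ re w
im (z +ᶜ w) = im z +ʳ im w
re (z *ᶜ w) = re z *ʳ re w +ʳ -ʳ (im z *ʳ im w)
im (z *ᶜ w) = re z *ʳ im w +ʳ im z *ʳ re w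

-ᶜ_ conjᶜ : ℂ → ℂ
re (-ᶜ z) = -ʳ re z
im (-ᶜ z) = -ʳ im z
re (conjᶜ z) = re z
im (conjᶜ z) = -ʳ im z

-- Stated over an arbitrary ring so that the solver does not unfold ℝ.
-- The solver is one for semirings: - x is fed to it as (- 1#) * x.
private
  module ComplexIdentities (S : CommutativeRing 0ℓ 0ℓ) where
    open CommutativeRing S renaming (trans to infixr 2 _then_; sym to infix 9 _⁻; refl to ≈-refl)
    open import Algebra.Properties.Ring ring using (-0#≈0#; -1*x≈-x)
    open import Algebra.Solver.Ring.NaturalCoefficients.Default commutativeSemiring

    neg : ∀ x → - x ≈ - 1# * x
    neg x = -1*x≈-x x ⁻

    re-assoc : ∀ a b c d e f →
      (a * c + - (b * d)) * e + - ((a * d + b * c) * f) ≈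
      a * (c * e + - (d * f)) + - (b * (c * f + d * e))
    re-assoc a b c d e f =
      +-cong (*-congʳ (+-congˡ (neg _))) (neg _) then
      solve 7 (λ j a b c d e f →
          (a :* c :+ j :* (b :* d)) :* e :+ j :* ((a :* d :+ b :* c) :* f) :=
          a :* (c :* e :+ j :* (d :* f)) :+ j :* (b :* (c :* f :+ d :* e)))
        ≈-refl (- 1#) a b c d e f then
      +-cong (*-congˡ (+-congˡ (neg _ ⁻))) (neg _ ⁻)

    im-assoc : ∀ a b c d e f →
      (a * c + - (b * d)) * f + (a * d + b * c) * e ≈
      a * (c * f + d * e) + b * (c * e + - (d * f))
    im-assoc a b c d e f =
      +-congʳ (*-congʳ (+-congˡ (neg _))) then
      solve 7 (λ j a b c d e f →
          (a :* c :+ j :* (b :* d)) :* f :+ (a :* d :+ b :* c) :* e :=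
          a :* (c :* f :+ d :* e) :+ b :* (c :* e :+ j :* (d :* f)))
        ≈-refl (- 1#) a b c d e f then
      +-congˡ (*-congˡ (+-congˡ (neg _ ⁻)))

    re-distribˡ : ∀ a b c d e f →
      a * (c + e) + - (b * (d + f)) ≈ (a * c + - (b * d)) + (a * e + - (b * f))
    re-distribˡ a b c d e f =
      +-congˡ (neg _) then
      solve 7 (λ j a b c d e f →
          a :* (c :+ e) :+ j :* (b :* (d :+ f)) :=
          (a :* c :+ j :* (b :* d)) :+ (a :* e :+ j :* (b :* f)))
        ≈-refl (- 1#) a b c d e f then
      +-cong (+-congˡ (neg _ ⁻)) (+-congˡ (neg _ ⁻))

    im-distribˡ : ∀ a b c d e f →
      a * (d + f) + b * (c + e) ≈ (a * d + b * c) + (a * f + b * e)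
    im-distribˡ = solve 6 (λ a b c d e f →
      a :* (d :+ f) :+ b :* (c :+ e) := (a :* d :+ b :* c) :+ (a :* f :+ b :* e)) ≈-refl

    re-distribʳ : ∀ a b c d e f →
      (c + e) * a + - ((d + f) * b) ≈ (c * a + - (d * b)) + (e * a + - (f * b))
    re-distribʳ a b c d e f =
      +-congˡ (neg _) then
      solve 7 (λ j a b c d e f →
          (c :+ e) :* a :+ j :* ((d :+ f) :* b) :=
          (c :* a :+ j :* (d :* b)) :+ (e :* a :+ j :* (f :* b)))
        ≈-refl (- 1#) a b c d e f then
      +-cong (+-congˡ (neg _ ⁻)) (+-congˡ (neg _ ⁻))

    im-distribʳ : ∀ a b c d e f →
      (c + e) * b + (d + f) * a ≈ (c * b + d * a) + (e * b + f * a)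
    im-distribʳ = solve 6 (λ a b c d e f →
      (c :+ e) :* b :+ (d :+ f) :* a := (c :* b :+ d :* a) :+ (e :* b :+ f :* a)) ≈-refl

    re-comm : ∀ a b c d → a * c + - (b * d) ≈ c * a + - (d * b)
    re-comm a b c d = +-cong (*-comm a c) (-‿cong (*-comm b d))

    im-comm : ∀ a b c d → a * d + b * c ≈ c * b + d * a
    im-comm = solve 4 (λ a b c d → a :* d :+ b :* c := c :* b :+ d :* a) ≈-refl

    re-idˡ : ∀ a b → 1# * a + - (0# * b) ≈ a
    re-idˡ a b = +-cong (*-identityˡ a) (-‿cong (zeroˡ b) then -0#≈0#) then +-identityʳ a

    im-idˡ : ∀ a b → 1# * b + 0# * a ≈ b
    im-idˡ a b = +-cong (*-identityˡ b) (zeroˡ a) then +-identityʳ b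

    re-idʳ : ∀ a b → a * 1# + - (b * 0#) ≈ a
    re-idʳ a b = +-cong (*-identityʳ a) (-‿cong (zeroʳ b) then -0#≈0#) then +-identityʳ a

    im-idʳ : ∀ a b → a * 0# + b * 1# ≈ b
    im-idʳ a b = +-cong (zeroʳ a) (*-identityʳ b) then +-identityˡ b

  module R = CommutativeRing ℝ-ring
  open ComplexIdentities ℝ-ring

ℂ-ring : CommutativeRing 0ℓ 0ℓ
ℂ-ring = record
  { Carrier = ℂ ; _≈_ = _≈ᶜ_ ; _+_ = _+ᶜ_ ; _*_ = _*ᶜ_ ; -_ = -ᶜ_
  ; 0# = fromℚᶜ 0ℚ ; 1# = fromℚᶜ 1ℚ
  ; isCommutativeRing = record
    { isRing = record
      { +-isAbelianGroup = record
        { isGroup = record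
          { isMonoid = record
            { isSemigroup = record
              { isMagma = record
                { isEquivalence = record
                  { refl  = mk≈ᶜ R.refl R.refl
                  ; sym   = λ p → mk≈ᶜ (R.sym (re≈ p)) (R.sym (im≈ p))
                  ; trans = λ p q → mk≈ᶜ (R.trans (re≈ p) (re≈ q)) (R.trans (im≈ p) (im≈ q))
                  }
                ; ∙-cong = λ p q → mk≈ᶜ (R.+-cong (re≈ p) (re≈ q)) (R.+-cong (im≈ p) (im≈ q))
                }
              ; assoc = λ x y z →
                  mk≈ᶜ (R.+-assoc (re x) (re y) (re z)) (R.+-assoc (im x) (im y) (im z))
              }
            ; identity = (λ x → mk≈ᶜ (R.+-identityˡ (re x)) (R.+-identityˡ (im x)))
                       , (λ x → mk≈ᶜ (R.+-identityʳ (re x)) (R.+-identityʳ (im x)))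
            }
          ; inverse = (λ x → mk≈ᶜ (R.-‿inverseˡ (re x)) (R.-‿inverseˡ (im x)))
                    , (λ x → mk≈ᶜ (R.-‿inverseʳ (re x)) (R.-‿inverseʳ (im x)))
          ; ⁻¹-cong = λ p → mk≈ᶜ (R.-‿cong (re≈ p)) (R.-‿cong (im≈ p))
          }
        ; comm = λ x y → mk≈ᶜ (R.+-comm (re x) (re y)) (R.+-comm (im x) (im y))
        }
      ; *-cong = λ p q → mk≈ᶜ
          (R.+-cong (R.*-cong (re≈ p) (re≈ q)) (R.-‿cong (R.*-cong (im≈ p) (im≈ q))))
          (R.+-cong (R.*-cong (re≈ p) (im≈ q)) (R.*-cong (im≈ p) (re≈ q)))
      ; *-assoc = λ x y z →
          mk≈ᶜ (re-assoc (re x) (im x) (re y) (im y) (re z) (im z))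
               (im-assoc (re x) (im x) (re y) (im y) (re z) (im z))
      ; *-identity = (λ x → mk≈ᶜ (re-idˡ (re x) (im x)) (im-idˡ (re x) (im x)))
                   , (λ x → mk≈ᶜ (re-idʳ (re x) (im x)) (im-idʳ (re x) (im x)))
      ; distrib =
          (λ x y z → mk≈ᶜ (re-distribˡ (re x) (im x) (re y) (im y) (re z) (im z))
                           (im-distribˡ (re x) (im x) (re y) (im y) (re z) (im z)))
        , (λ x y z → mk≈ᶜ (re-distribʳ (re x) (im x) (re y) (im y) (re z) (im z))
                           (im-distribʳ (re x) (im x) (re y) (im y) (re z) (im z)))
      }
    ; *-comm = λ x y → mk≈ᶜ (re-comm (re x) (im x) (re y) (im y)) (im-comm (re x) (im x) (re y) (im y))
    }
  }

-- The zeon algebra, by generators and relations: terms over ℂ and the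
-- generators, modulo the least congruence satisfying the axioms of a
-- commutative unital ℂ-algebra together with ζ i * ζ i = 0.
data Zeon : Set where
  scalar   : ℂ → Zeon
  ζ        : (i : ℕ) → .{{ℕ.NonZero i}} → Zeon
  _⊕_ _⊗_  : Zeon → Zeon → Zeon
  ⊖_       : Zeon → Zeon

infix  4 _≈ᶻ_
infixl 6 _⊕_
infixl 7 _⊗_
infix  8 ⊖_

data _≈ᶻ_ : Rel Zeon 0ℓ where
  reflᶻ  : ∀ {u} → u ≈ᶻ u
  symᶻ   : ∀ {u v} → u ≈ᶻ v → v ≈ᶻ u
  transᶻ : ∀ {u v w} → u ≈ᶻ v → v ≈ᶻ w → u ≈ᶻ w

  ⊕-cong : ∀ {u u′ v v′} → u ≈ᶻ u′ → v ≈ᶻ v′ → u ⊕ v ≈ᶻ u′ ⊕ v′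
  ⊗-cong : ∀ {u u′ v v′} → u ≈ᶻ u′ → v ≈ᶻ v′ → u ⊗ v ≈ᶻ u′ ⊗ v′
  ⊖-cong : ∀ {u u′} → u ≈ᶻ u′ → ⊖ u ≈ᶻ ⊖ u′

  ⊕-assoc     : ∀ u v w → (u ⊕ v) ⊕ w ≈ᶻ u ⊕ (v ⊕ w)
  ⊕-comm      : ∀ u v → u ⊕ v ≈ᶻ v ⊕ u
  ⊕-identityˡ : ∀ u → scalar (fromℚᶜ 0ℚ) ⊕ u ≈ᶻ u
  ⊖-inverseˡ  : ∀ u → ⊖ u ⊕ u ≈ᶻ scalar (fromℚᶜ 0ℚ)
  ⊗-assoc     : ∀ u v w → (u ⊗ v) ⊗ w ≈ᶻ u ⊗ (v ⊗ w)
  ⊗-comm      : ∀ u v → u ⊗ v ≈ᶻ v ⊗ u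
  ⊗-identityˡ : ∀ u → scalar (fromℚᶜ 1ℚ) ⊗ u ≈ᶻ u
  ⊗-distribˡ  : ∀ u v w → u ⊗ (v ⊕ w) ≈ᶻ (u ⊗ v) ⊕ (u ⊗ w)

  scalar-cong : ∀ {a b} → a ≈ᶜ b → scalar a ≈ᶻ scalar b
  scalar-+    : ∀ a b → scalar (a +ᶜ b) ≈ᶻ scalar a ⊕ scalar b
  scalar-*    : ∀ a b → scalar (a *ᶜ b) ≈ᶻ scalar a ⊗ scalar b

  ζ²≈0 : ∀ i .{{_ : ℕ.NonZero i}} → ζ i ⊗ ζ i ≈ᶻ scalar (fromℚᶜ 0ℚ)

private
  via-comm : ∀ {u v w} → v ⊕ u ≈ᶻ w → u ⊕ v ≈ᶻ w
  via-comm = transᶻ (⊕-comm _ _)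

Zeon-ring : CommutativeRing 0ℓ 0ℓ
Zeon-ring = record
  { Carrier = Zeon ; _≈_ = _≈ᶻ_ ; _+_ = _⊕_ ; _*_ = _⊗_ ; -_ = ⊖_
  ; 0# = scalar (fromℚᶜ 0ℚ) ; 1# = scalar (fromℚᶜ 1ℚ)
  ; isCommutativeRing = record
    { isRing = record
      { +-isAbelianGroup = record
        { isGroup = record
          { isMonoid = record
            { isSemigroup = record
              { isMagma = record
                { isEquivalence = record { refl = reflᶻ ; sym = symᶻ ; trans = transᶻ }
                ; ∙-cong = ⊕-cong
                }
              ; assoc = ⊕-assoc
              }
            ; identity = ⊕-identityˡ , λ u → via-comm (⊕-identityˡ u)
            }
          ; inverse = ⊖-inverseˡ , λ u → via-comm (⊖-inverseˡ u)
          ; ⁻¹-cong = ⊖-cong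
          }
        ; comm = ⊕-comm
        }
      ; *-cong = ⊗-cong
      ; *-assoc = ⊗-assoc
      ; *-identity = ⊗-identityˡ , λ u → transᶻ (⊗-comm _ _) (⊗-identityˡ u)
      ; distrib = ⊗-distribˡ , λ u v w →
          transᶻ (⊗-comm _ _) (transᶻ (⊗-distribˡ u v w) (⊕-cong (⊗-comm _ _) (⊗-comm _ _)))
      }
    ; *-comm = ⊗-comm
    }
  }

-- The coefficient of ζ_∅: since every other ζ_I lies in the ideal
-- spanned by the generators, it is multiplicative and kills each ζ i.
ℭ : Zeon → ℂ
ℭ (scalar a) = a
ℭ (ζ _)      = fromℚᶜ 0ℚ
ℭ (u ⊕ v)    = ℭ u +ᶜ ℭ v
ℭ (u ⊗ v)    = ℭ u *ᶜ ℭ v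
ℭ (⊖ u)      = -ᶜ ℭ u

ℭ-cong : ∀ {u v} → u ≈ᶻ v → ℭ u ≈ᶜ ℭ v
ℭ-cong = go
  where
  module C = CommutativeRing ℂ-ring
  go : ∀ {u v} → u ≈ᶻ v → ℭ u ≈ᶜ ℭ v
  go reflᶻ              = C.refl
  go (symᶻ p)           = C.sym (go p)
  go (transᶻ p q)       = C.trans (go p) (go q)
  go (⊕-cong p q)       = C.+-cong (go p) (go q)
  go (⊗-cong p q)       = C.*-cong (go p) (go q)
  go (⊖-cong p)         = C.-‿cong (go p)
  go (⊕-assoc u v w)    = C.+-assoc (ℭ u) (ℭ v) (ℭ w)
  go (⊕-comm u v)       = C.+-comm (ℭ u) (ℭ v)
  go (⊕-identityˡ u)    = C.+-identityˡ (ℭ u)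
  go (⊖-inverseˡ u)     = C.-‿inverseˡ (ℭ u)
  go (⊗-assoc u v w)    = C.*-assoc (ℭ u) (ℭ v) (ℭ w)
  go (⊗-comm u v)       = C.*-comm (ℭ u) (ℭ v)
  go (⊗-identityˡ u)    = C.*-identityˡ (ℭ u)
  go (⊗-distribˡ u v w) = C.distribˡ (ℭ u) (ℭ v) (ℭ w)
  go (scalar-cong p)    = p
  go (scalar-+ a b)     = C.refl
  go (scalar-* a b)     = C.refl
  go (ζ²≈0 i)           = C.zeroˡ (fromℚᶜ 0ℚ)

conj : Zeon → Zeon
conj (scalar a) = scalar (conjᶜ a)
conj (ζ i)      = ζ i
conj (u ⊕ v)    = conj u ⊕ conj v
conj (u ⊗ v)    = conj u ⊗ conj v
conj (⊖ u)      = ⊖ conj u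

Matrix : Set → ℕ → Set
Matrix A m = Fin m → Fin m → A

module RingOps (R : RawRing 0ℓ 0ℓ) where
  open RawRing R
  open RawSemiringDefs rawSemiring public using (sum; product; _^_)

  sumSubsets : ∀ {m} → (Subset m → Carrier) → Carrier
  sumSubsets {zero}  F = F []
  sumSubsets {suc m} F = sumSubsets (F ∘ (outside ∷_)) + sumSubsets (F ∘ (inside ∷_))

  productOver : ∀ {m} (I : Subset m) → (∀ j → j ∈ I → Carrier) → Carrier
  productOver I F = product λ j → factor j
    where
    factor : _ → Carrier
    factor j with j ∈? I
    ... | yes j∈I = F j j∈I
    ... | no  _   = 1#

  -- Cofactor expansion along the first row.
  det : ∀ {m} → Matrix Carrier m → Carrier
  det {zero}  M = 1#
  det {suc m} M = sum λ j →
    ((- 1#) ^ toℕ j) * M zero j * det (λ i k → M (suc i) (punchIn j k))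

-- Polynomials are lists of coefficients, constant term first; trailing
-- zeros are allowed, so they are compared coefficient by coefficient.
module Polynomials (R : RawRing 0ℓ 0ℓ) where
  open RawRing R

  Poly : Set
  Poly = List Carrier

  coeff : Poly → ℕ → Carrier
  coeff []      _       = 0#
  coeff (a ∷ p) zero    = a
  coeff (a ∷ p) (suc n) = coeff p n

  _≈ₚ_ : Rel Poly 0ℓ
  p ≈ₚ q = ∀ n → coeff p n ≈ coeff q n

  _+ₚ_ _*ₚ_ : Poly → Poly → Poly
  []      +ₚ q       = q
  (a ∷ p) +ₚ []      = a ∷ p
  (a ∷ p) +ₚ (b ∷ q) = (a + b) ∷ (p +ₚ q)
  []      *ₚ q       = []
  (a ∷ p) *ₚ q       = map (a *_) q +ₚ (0# ∷ (p *ₚ q))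

  polyRawRing : RawRing 0ℓ 0ℓ
  polyRawRing = record
    { Carrier = Poly ; _≈_ = _≈ₚ_ ; _+_ = _+ₚ_ ; _*_ = _*ₚ_ ; -_ = map -_
    ; 0# = [] ; 1# = 1# ∷ [] }

  X : Poly
  X = 0# ∷ 1# ∷ []

  const : Carrier → Poly
  const a = a ∷ []

  eval : Poly → Carrier → Carrier
  eval []      x = 0#
  eval (a ∷ p) x = a + x * eval p x

  IsSimpleZero : Poly → Carrier → Set
  IsSimpleZero p a = ∃ λ g →
    p ≈ₚ ((X +ₚ const (- a)) *ₚ g) × ¬ (eval g a ≈ 0#)

  charPoly : ∀ {m} → Matrix Carrier m → Poly
  charPoly M = RingOps.det polyRawRing λ i j → diagonal i j +ₚ const (- M i j)
    where
    diagonal : Matrix Poly _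
    diagonal i j with i Fin.≟ j
    ... | yes _ = X
    ... | no  _ = []

module ℂᵣ = CommutativeRing ℂ-ring
module ℂOps = RingOps ℂᵣ.rawRing
module ℂPoly = Polynomials ℂᵣ.rawRing

module Zᵣ = CommutativeRing Zeon-ring
module ZeonOps = RingOps Zᵣ.rawRing
module ZeonPoly = Polynomials Zᵣ.rawRing

ζ[_] : ∀ {m} → Subset m → Zeon
ζ[ I ] = ZeonOps.productOver I λ j _ → ζ (suc (toℕ j))

NonNull : ∀ {m} → Vector Zeon m → Set
NonNull ξ = ¬ (ℭ (ZeonOps.sum λ i → conj (ξ i) ⊗ ξ i) ≈ᶜ fromℚᶜ 0ℚ)

IsEigenvalue : ∀ {m} → Matrix Zeon m → Zeon → Set
IsEigenvalue A μ = ∃ λ ξ → NonNull ξ ×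
  (∀ i → ZeonOps.sum (λ j → A i j ⊗ ξ j) ≈ᶻ μ ⊗ ξ i)

IsSpectrallySimpleEigenvalue : ∀ {m} → Matrix Zeon m → Zeon → Set
IsSpectrallySimpleEigenvalue A μ =
  IsEigenvalue A μ ×
  ZeonPoly.IsSimpleZero (ZeonPoly.charPoly A) μ ×
  ℂPoly.IsSimpleZero (map ℭ (ZeonPoly.charPoly A)) (ℭ μ)

-- i : Fin m stands for the vertex v_{i+1}, whence ζ (suc (toℕ i)) below.
-- Adjacency is decidable because Ψ is defined by cases on it.
record SimpleGraph (m : ℕ) : Set₁ where
  field
    Adj     : Rel (Fin m) 0ℓ
    adj?    : Decidable Adj
    adj-sym : Symmetric Adj
    irrefl  : Irreflexive _≡_ Adj

open SimpleGraph public

Ψ : ∀ {m} → SimpleGraph m → Matrix Zeon m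
Ψ G i j with adj? G i j
... | yes _ = ζ (suc (toℕ j))
... | no  _ = Zᵣ.0#

fromℤᶜ : ℤ → ℂ
fromℤᶜ z = fromℚᶜ (z ℚ./ 1)

Δ : ∀ {m} → (Fin m → ℕ) → Matrix Zeon m
Δ f i j with i Fin.≟ j
... | yes _ = scalar (fromℤᶜ (+ f i))
... | no  _ = Zᵣ.0#

laplacian : ∀ {m} → SimpleGraph m → (Fin m → ℕ) → Matrix Zeon m
laplacian G f i j = Δ f i j Zᵣ.- Ψ G i j

-- (w₀ , … , w_k), of arbitrary length k.
VertexSeq : ℕ → Set
VertexSeq m = Σ ℕ λ k → Vec (Fin m) (suc k)

record IsCycleOn {m} (G : SimpleGraph m) (v : Fin m) (I : Subset m)
                 (c : VertexSeq m) : Set where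
  k : ℕ
  k = proj₁ c

  w : Fin (suc k) → Fin m
  w = lookup (proj₂ c)

  field
    -- Otherwise the sequence (v) of length 0 would count for I = ∅.
    nontrivial : 1 ℕ.≤ k
    starts     : w zero ≡ v
    ends       : w (fromℕ k) ≡ v
    adjacent   : ∀ (i : Fin k) → Adj G (w (inject₁ i)) (w (suc i))
    distinct   : Injective _≡_ _≡_ (w ∘ inject₁)
    vertices   : ∀ j → j ∈ I ⇔ ∃ λ i → w (inject₁ i) ≡ j

HasCount : {A : Set} → (A → Set) → ℕ → Set
HasCount P n = ∃ λ xs → Unique xs × (∀ x → x List.∈ xs ⇔ P x) × length xs ≡ n

difference : ℕ → ℕ → ℚ
difference a b = (+ a ℤ.- + b) ℚ./ 1

difference≢0 : ∀ {a b} → a ≢ b → difference a b ≢ 0ℚ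
difference≢0 {a} {b} a≢b eq with ℚ./-injective-≃ (mkℚᵘ (+ a ℤ.- + b) 0) (mkℚᵘ (+ 0) 0) eq
... | *≡* e = a≢b (ℤ.+-injective (ℤ.i-j≡0⇒i≡j (+ a) (+ b) (trans (sym (ℤ.*-identityʳ _)) e)))

-- f_ℓ - f_j is rational, so its inverse in ℂ is computed in ℚ.
inverseDifference : ∀ a b → a ≢ b → ℂ
inverseDifference a b a≢b = fromℚᶜ (ℚ.1/_ (difference a b) {{ℚ.≢-nonZero (difference≢0 a≢b)}})

private
  x∉I-x : ∀ {m} (I : Subset m) x → ¬ x ∈ I Subset.- x
  x∉I-x (_ ∷ _) zero    ()
  x∉I-x (_ ∷ I) (suc x) (there p) = x∉I-x I x p

coefficient : ∀ {m} (f : Fin m → ℕ) → Injective _≡_ _≡_ f → Fin m → Subset m → ℂ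
coefficient f f-inj ℓ I = ℂOps.productOver (I Subset.- ℓ) λ j j∈I-ℓ →
  inverseDifference (f ℓ) (f j) λ fℓ≡fj →
    x∉I-x I ℓ (subst (_∈ (I Subset.- ℓ)) (sym (f-inj fℓ≡fj)) j∈I-ℓ)

{-# OPTIONS --safe #-}
-- Let d ℓ = 1 and d i = 1 / (f ℓ - f i) for i ≠ ℓ, and let y be the Neumann
-- series Σₙ (- d Ψ)ⁿ e_ℓ.  It is finite, since a walk with more than m
-- steps enters some vertex twice and ζ i ² = 0.  All terms with n ≥ 1 are
-- multiples of ζ ℓ, hence orthogonal to each other, which makes y an
-- eigenvector for f ℓ + (y ℓ - 1).  The surviving terms of y ℓ are the cycles
-- based at ℓ.
--
-- For simplicity of the root, det (μ - Λ) vanishes because y ℓ is invertible,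
-- so μ is a root of χ, and the scalar part of χ′ μ is ∏ (f ℓ - f i) ≠ 0, as
-- the scalar part of Λ is diagonal.
module Submission where

open import Defs
open import Algebra.Bundles using (RawRing; CommutativeRing; CommutativeMonoid)
open import Data.Bool using (if_then_else_)
open import Data.Bool.Properties using () renaming (_≟_ to _≟ᵇ_)
open import Data.Empty using (⊥)
open import Data.Fin using (Fin; zero; suc; _<_; toℕ; fromℕ; inject₁; punchIn; punchOut; _≟_)
open import Data.Fin.Properties
  using (<⇒≢; punchInᵢ≢i; punchIn-punchOut; punchIn-injective; pigeonhole;
  any?; all?; ¬∀⟶∃¬; injective⇒≤)
open import Data.Fin.Subset using (Subset; _∈_; inside; outside; ∣_∣)
import Data.Fin.Subset as Subset
open import Data.Fin.Subset.Properties using (_∈?_; ⊆-antisym; p─q⊆p; x∈p∧x≢y⇒x∈p-y)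
open import Data.List using (List; []; _∷_; map; _++_; tabulate; allFin; cartesianProductWith; filter; length)
import Data.List.Membership.Propositional as List
open import Data.List.Membership.Propositional.Properties
  using (∈-filter⁺; ∈-filter⁻; ∈-++⁺ˡ; ∈-++⁺ʳ; ∈-++⁻; ∈-map⁺; ∈-map⁻; ∈-allFin; ∈-cartesianProductWith⁺)
open import Data.List.Relation.Unary.All using ([])
open import Data.List.Relation.Unary.AllPairs using ([]; _∷_)
open import Data.List.Relation.Unary.Any using (here)
open import Data.List.Relation.Unary.Unique.Propositional using (Unique)
open import Data.List.Relation.Unary.Unique.Propositional.Properties
  using (++⁺; map⁺; filter⁺; allFin⁺; cartesianProductWith⁺)
open import Data.Nat using (ℕ; zero; suc; NonZero; _≤_; s≤s; z≤n)
import Data.Nat as ℕ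
open import Data.Nat.Properties
  using (≤-trans; <⇒≤; n<1+n; ≤-refl; m≤n⇒m≤1+n; 1+n≰n; m≤n⇒m<n∨m≡n; ≤-pred)
import Data.Nat.Properties as ℕ
open import Data.Product using (∃; _×_; _,_; proj₁; proj₂)
open import Data.Rational as ℚ using (ℚ; ½)
import Data.Rational.Properties as ℚ
import Data.Rational.Unnormalised as ℚᵘ
import Data.Rational.Unnormalised.Properties as ℚᵘ
open import Data.Sum using (_⊎_; inj₁; inj₂)
open import Data.Vec using (Vec; []; _∷_; lookup; there)
import Data.Vec as Vec
import Data.Vec.Properties as Vec
open import Data.Vec.Functional using (updateAt)
open import Data.Vec.Functional.Properties
  using (updateAt-updates; updateAt-minimal; updateAt-commutes; updateAt-id-local)
open import Function using (_∘_; _⇔_; Equivalence; mk⇔)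
open import Function.Definitions using (Injective)
open import Level using (0ℓ)
open import Relation.Binary.PropositionalEquality as ≡ using (_≡_; _≢_)
open import Relation.Nullary using (¬_; Dec; does; yes; no; contradiction; ¬?; _×-dec_)
import Relation.Unary as U

-- The generator at `ℓ` makes the eigenvalue problem linear. Put `q = y ℓ - 1`. For `i ≠ ℓ` the
-- product `q * y i` of two unknowns drops out of row `i`, leaving `(f ℓ - f i) y i = - (Ψ y) i`; in
-- row `ℓ` it contributes `q * y ℓ = q`, leaving `q = - (Ψ y) ℓ`. With `d ℓ = 1` both cases read
-- `y = e - d Ψ y`, whose iteration is the Neumann series. The same choice makes `ℓ` neutral in
-- products of the `d j`, so a product over `I` is also one over `I` without `ℓ`. Two obstacles
-- shape the rest. Zeons have zero divisors, so a kernel vector yields only that each of its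
-- components annihilates the determinant, and an invertible component is required; likewise
-- nonvanishing is carried by explicit inverses, after passing to scalar parts. And polynomials are
-- bare lists of coefficients without established ring laws, so a determinant of polynomials is
-- studied only through its images, its value and its derivative at a point, in a commutative ring.

module MonoidSums (M : CommutativeMonoid 0ℓ 0ℓ) where
  open CommutativeMonoid M
  open import Algebra.Properties.CommutativeMonoid.Sum M public

  sum-cong : ∀ {n} {s t : Fin n → Carrier} → (∀ i → s i ≈ t i) → sum s ≈ sum t
  sum-cong = sum-cong-≋

  sum-ε : ∀ {n} {t : Fin n → Carrier} → (∀ i → t i ≈ ε) → sum t ≈ ε
  sum-ε {n} t≈ε = trans (sum-cong t≈ε) (sum-replicate-zero n)

  sum-single : ∀ {n} (t : Fin n → Carrier) i → (∀ j → j ≢ i → t j ≈ ε) → sum t ≈ t i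
  sum-single {suc n} t i off =
    trans (sum-remove t)
      (trans (∙-congˡ (sum-ε λ j → off (punchIn i j) (punchInᵢ≢i i j))) (identityʳ (t i)))

-- Adjacent columns and the order of columns

data Adjacent : ∀ {n} → Fin n → Fin n → Set where
  here  : ∀ {n} → Adjacent {suc (suc n)} zero (suc zero)
  there : ∀ {n} {p q : Fin n} → Adjacent p q → Adjacent (suc p) (suc q)

-- The strict order of `Fin n` as a chain of unit steps that grows at its right end: the proof that
-- equal columns give determinant zero moves the right column one step to the left at a time.
data _⋖_ {n} (p : Fin n) : Fin n → Set where
  adjacent : ∀ {q} → Adjacent p q → p ⋖ q
  step     : ∀ {r q} → p ⋖ r → Adjacent r q → p ⋖ q

⋖-suc : ∀ {n} {p q : Fin n} → p ⋖ q → suc p ⋖ suc q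
⋖-suc (adjacent a) = adjacent (there a)
⋖-suc (step g a)   = step (⋖-suc g) (there a)

zero⋖suc : ∀ {n} (q : Fin n) → zero ⋖ suc q
zero⋖suc zero    = adjacent here
zero⋖suc (suc q) = extend (⋖-suc (zero⋖suc q))
  where
  extend : ∀ {n} {q : Fin (suc (suc n))} → suc zero ⋖ q → zero ⋖ q
  extend (adjacent a) = step (adjacent here) a
  extend (step g a)   = step (extend g) a

⋖-total : ∀ {n} (p q : Fin n) → p ≢ q → p ⋖ q ⊎ q ⋖ p
⋖-total zero    zero    p≢q = contradiction ≡.refl p≢q
⋖-total zero    (suc q) p≢q = inj₁ (zero⋖suc q)
⋖-total (suc p) zero    p≢q = inj₂ (zero⋖suc p)
⋖-total (suc p) (suc q) p≢q with ⋖-total p q (p≢q ∘ ≡.cong suc)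
... | inj₁ g = inj₁ (⋖-suc g)
... | inj₂ g = inj₂ (⋖-suc g)

Adjacent⇒< : ∀ {n} {p q : Fin n} → Adjacent p q → p < q
Adjacent⇒< here      = s≤s z≤n
Adjacent⇒< (there a) = s≤s (Adjacent⇒< a)

⋖⇒< : ∀ {n} {p q : Fin n} → p ⋖ q → p < q
⋖⇒< (adjacent a)           = Adjacent⇒< a
⋖⇒< {p = p} (step {r} g a) = ≤-trans (⋖⇒< g) (<⇒≤ (Adjacent⇒< a))

-- The cases for the cofactor of column `j`. In `elsewhere` both columns survive in the minor, as
-- the still adjacent `p′` and `q′`, so induction applies to it.
data Position {n} (p q j : Fin (suc n)) : Set where
  left      : j ≡ p → Position p q j
  right     : j ≡ q → Position p q j
  elsewhere : ∀ {p′ q′} → Adjacent p′ q′ → punchIn j p′ ≡ p → punchIn j q′ ≡ q → Position p q j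

position : ∀ {n} {p q : Fin (suc n)} → Adjacent p q → ∀ j → Position p q j
position here zero                    = left ≡.refl
position here (suc zero)              = right ≡.refl
position {suc (suc n)} here (suc (suc j)) = elsewhere here ≡.refl ≡.refl
position (there a) zero               = elsewhere a ≡.refl ≡.refl
position {suc n} (there a) (suc j) with position a j
... | left e = left (≡.cong suc e)
... | right e = right (≡.cong suc e)
... | elsewhere a′ e f = elsewhere (there a′) (≡.cong suc e) (≡.cong suc f)

-- Deleting one or the other of two neighbours leaves the same columns in the same order, except
-- that one place holds the neighbour that was kept.
punchIn-adjacent : ∀ {n} {p q : Fin (suc n)} → Adjacent p q → ∀ k →
  punchIn p k ≡ punchIn q k ⊎ (punchIn p k ≡ q × punchIn q k ≡ p)
punchIn-adjacent here zero    = inj₂ (≡.refl , ≡.refl)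
punchIn-adjacent here (suc k) = inj₁ ≡.refl
punchIn-adjacent (there a) zero = inj₁ ≡.refl
punchIn-adjacent (there a) (suc k) with punchIn-adjacent a k
... | inj₁ e       = inj₁ (≡.cong suc e)
... | inj₂ (e , f) = inj₂ (≡.cong suc e , ≡.cong suc f)

-- Multilinearity and alternation of the determinant in its columns

module Determinants (R : CommutativeRing 0ℓ 0ℓ) where
  open CommutativeRing R hiding (zero)
  open RingOps rawRing
  open import Algebra.Properties.Ring ring
  open MonoidSums +-commutativeMonoid hiding (sum)
  open import Algebra.Properties.Semiring.Sum semiring using (*-distribˡ-sum; *-distribʳ-sum)
  open import Algebra.Solver.Ring.NaturalCoefficients.Default commutativeSemiring
    using (solve; _:=_; _:+_; _:*_)
  open import Relation.Binary.Reasoning.Setoid setoid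

  det-cong : ∀ {m} {M N : Matrix Carrier m} → (∀ i j → M i j ≈ N i j) → det M ≈ det N
  det-cong {zero}  M≈N = refl
  det-cong {suc m} M≈N = sum-cong λ j →
    *-cong (*-congˡ {(- 1#) ^ toℕ j} (M≈N zero j)) (det-cong λ i k → M≈N (suc i) (punchIn j k))

  -- Additivity and homogeneity in a single statement, so that one induction along the first row
  -- serves both. Each summand depends linearly on column `p`: through its entry if `j` is `p`,
  -- through its minor otherwise.
  det-linear : ∀ {m} (p : Fin m) c {L M N : Matrix Carrier m} →
    (∀ i → L i p ≈ c * M i p + N i p) →
    (∀ i k → k ≢ p → L i k ≈ M i k) → (∀ i k → k ≢ p → L i k ≈ N i k) →
    det L ≈ c * det M + det N
  det-linear {suc m} p c {L} {M} {N} at-p L≈M L≈N = begin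
    sum (term L)                                  ≈⟨ sum-cong split ⟩
    sum (λ j → c * term M j + term N j)           ≈⟨ ∑-distrib-+ (λ j → c * term M j) (term N) ⟩
    sum (λ j → c * term M j) + sum (term N)       ≈⟨ +-congʳ (*-distribˡ-sum c (term M)) ⟨
    c * sum (term M) + sum (term N)               ∎
    where
    sign : Fin (suc m) → Carrier
    sign j = (- 1#) ^ toℕ j

    minor : Matrix Carrier (suc m) → Fin (suc m) → Matrix Carrier m
    minor A j i k = A (suc i) (punchIn j k)

    term : Matrix Carrier (suc m) → Fin (suc m) → Carrier
    term A j = sign j * A zero j * det (minor A j)

    split : ∀ j → term L j ≈ c * term M j + term N j
    split j with j ≟ p
    ... | yes ≡.refl = begin
      sign j * L zero j * det (minor L j)
        ≈⟨ *-congʳ (*-congˡ (at-p zero)) ⟩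
      sign j * (c * M zero j + N zero j) * det (minor L j)
        ≈⟨ solve 5 (λ s c a b d → s :* (c :* a :+ b) :* d := c :* (s :* a :* d) :+ s :* b :* d)
             refl (sign j) c (M zero j) (N zero j) (det (minor L j)) ⟩
      c * (sign j * M zero j * det (minor L j)) + sign j * N zero j * det (minor L j)
        ≈⟨ +-cong (*-congˡ (*-congˡ (det-cong λ i k → L≈M (suc i) (punchIn j k) (punchInᵢ≢i j k))))
                  (*-congˡ (det-cong λ i k → L≈N (suc i) (punchIn j k) (punchInᵢ≢i j k))) ⟩
      c * term M j + term N j ∎
    -- `punchOut` gives the index that column `p` has in the minor omitting `j`.
    ... | no j≢p with punchOut j≢p | punchIn-punchOut j≢p
    ...   | q | ≡.refl = begin
      sign j * L zero j * det (minor L j)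
        ≈⟨ *-congˡ (det-linear q c (λ i → at-p (suc i))
             (λ i k k≢q → L≈M (suc i) (punchIn j k) (k≢q ∘ punchIn-injective j k q))
             (λ i k k≢q → L≈N (suc i) (punchIn j k) (k≢q ∘ punchIn-injective j k q))) ⟩
      sign j * L zero j * (c * det (minor M j) + det (minor N j))
        ≈⟨ solve 5 (λ s c a d e → s :* a :* (c :* d :+ e) := c :* (s :* a :* d) :+ s :* a :* e)
             refl (sign j) c (L zero j) (det (minor M j)) (det (minor N j)) ⟩
      c * (sign j * L zero j * det (minor M j)) + sign j * L zero j * det (minor N j)
        ≈⟨ +-cong (*-congˡ (*-congʳ (*-congˡ (L≈M zero j j≢p)))) (*-congʳ (*-congˡ (L≈N zero j j≢p))) ⟩
      c * term M j + term N j ∎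

  -- A zero column is `- 1#` times itself plus itself, so linearity gives `det M = - det M + det M`.
  det-zero-column : ∀ {m} (p : Fin m) {M : Matrix Carrier m} → (∀ i → M i p ≈ 0#) → det M ≈ 0#
  det-zero-column p {M} col≈0 = begin
    det M                  ≈⟨ det-linear p (- 1#) column (λ _ _ _ → refl) (λ _ _ _ → refl) ⟩
    - 1# * det M + det M   ≈⟨ +-congʳ (-1*x≈-x (det M)) ⟩
    - det M + det M        ≈⟨ -‿inverseˡ (det M) ⟩
    0#                     ∎
    where
    column : ∀ i → M i p ≈ - 1# * M i p + M i p
    column i = begin
      M i p                 ≈⟨ col≈0 i ⟩
      0#                    ≈⟨ -‿inverseˡ (M i p) ⟨
      - M i p + M i p       ≈⟨ +-congʳ (-1*x≈-x (M i p)) ⟨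
      - 1# * M i p + M i p  ∎

  sum-adjacent : ∀ {n} {p q : Fin n} (t : Fin n → Carrier) → Adjacent p q →
    t p + t q ≈ 0# → (∀ j → j ≢ p → j ≢ q → t j ≈ 0#) → sum t ≈ 0#
  sum-adjacent t here pair rest = begin
    t zero + (t (suc zero) + _)  ≈⟨ +-assoc _ _ _ ⟨
    (t zero + t (suc zero)) + _  ≈⟨ +-cong pair (sum-ε λ j → rest (suc (suc j)) (λ ()) (λ ())) ⟩
    0# + 0#                      ≈⟨ +-identityˡ 0# ⟩
    0#                           ∎
  sum-adjacent t (there a) pair rest = begin
    t zero + sum (t ∘ suc)  ≈⟨ +-cong (rest zero (λ ()) (λ ()))
                                 (sum-adjacent (t ∘ suc) a pair λ j j≢p j≢q →
                                   rest (suc j) (λ { ≡.refl → j≢p ≡.refl }) (λ { ≡.refl → j≢q ≡.refl })) ⟩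
    0# + 0#                 ≈⟨ +-identityˡ 0# ⟩
    0#                      ∎

  sign-adjacent : ∀ {n} {p q : Fin n} → Adjacent p q → (- 1#) ^ toℕ q ≈ - 1# * (- 1#) ^ toℕ p
  sign-adjacent here      = refl
  sign-adjacent (there a) = *-congˡ (sign-adjacent a)

  -- The cofactors of `p` and `q` have equal entries, equal minors and opposite signs; every other
  -- minor again has two equal adjacent columns. This cancels terms directly, whereas
  -- `det M = - det M` would not suffice in a ring where 2 cannot be cancelled.
  det-adjacent-columns : ∀ {m} {p q : Fin m} {M : Matrix Carrier m} → Adjacent p q →
    (∀ i → M i p ≈ M i q) → det M ≈ 0#
  det-adjacent-columns {suc m} {p} {q} {M} a p≈q = sum-adjacent term a pair rest
    where
    sign : Fin (suc m) → Carrier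
    sign j = (- 1#) ^ toℕ j

    minor : Fin (suc m) → Matrix Carrier m
    minor j i k = M (suc i) (punchIn j k)

    term : Fin (suc m) → Carrier
    term j = sign j * M zero j * det (minor j)

    minors : ∀ i k → minor q i k ≈ minor p i k
    minors i k with punchIn-adjacent a k
    ... | inj₁ e       = reflexive (≡.cong (M (suc i)) (≡.sym e))
    ... | inj₂ (e , f) = begin
      M (suc i) (punchIn q k)  ≡⟨ ≡.cong (M (suc i)) f ⟩
      M (suc i) p              ≈⟨ p≈q (suc i) ⟩
      M (suc i) q              ≡⟨ ≡.cong (M (suc i)) e ⟨
      M (suc i) (punchIn p k)  ∎

    pair : term p + term q ≈ 0#
    pair = begin
      term p + term q
        ≈⟨ +-congˡ (*-cong (*-cong (sign-adjacent a) (sym (p≈q zero))) (det-cong minors)) ⟩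
      term p + - 1# * sign p * M zero p * det (minor p)
        ≈⟨ +-congˡ (solve 4 (λ e s x d → e :* s :* x :* d := e :* (s :* x :* d)) refl
             (- 1#) (sign p) (M zero p) (det (minor p))) ⟩
      term p + - 1# * term p   ≈⟨ +-congˡ (-1*x≈-x (term p)) ⟩
      term p - term p          ≈⟨ -‿inverseʳ (term p) ⟩
      0#                       ∎

    rest : ∀ j → j ≢ p → j ≢ q → term j ≈ 0#
    rest j j≢p j≢q with position a j
    ... | left e  = contradiction e j≢p
    ... | right e = contradiction e j≢q
    ... | elsewhere a′ ≡.refl ≡.refl =
      trans (*-congˡ (det-adjacent-columns a′ (p≈q ∘ suc))) (zeroʳ _)

  _[_≔_] : ∀ {m} → Matrix Carrier m → Fin m → (Fin m → Carrier) → Matrix Carrier m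
  (M [ p ≔ v ]) i = updateAt (M i) p (λ _ → v i)

  ≔-updates : ∀ {m} (M : Matrix Carrier m) p v i → (M [ p ≔ v ]) i p ≡ v i
  ≔-updates M p v i = updateAt-updates p (M i)

  ≔-minimal : ∀ {m} (M : Matrix Carrier m) p v i k → k ≢ p → (M [ p ≔ v ]) i k ≡ M i k
  ≔-minimal M p v i k k≢p = updateAt-minimal k p (M i) k≢p

  det-≔-linear : ∀ {m} (M : Matrix Carrier m) p c x y →
    det (M [ p ≔ (λ i → c * x i + y i) ]) ≈ c * det (M [ p ≔ x ]) + det (M [ p ≔ y ])
  det-≔-linear M p c x y = det-linear p c
    (λ i → begin
      (M [ p ≔ (λ i → c * x i + y i) ]) i p       ≡⟨ ≔-updates M p (λ i → c * x i + y i) i ⟩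
      c * x i + y i                               ≡⟨ ≡.cong₂ (λ a b → c * a + b) (≔-updates M p x i) (≔-updates M p y i) ⟨
      c * (M [ p ≔ x ]) i p + (M [ p ≔ y ]) i p   ∎)
    (λ i k k≢p → reflexive (≡.trans (≔-minimal M p (λ i → c * x i + y i) i k k≢p) (≡.sym (≔-minimal M p x i k k≢p))))
    (λ i k k≢p → reflexive (≡.trans (≔-minimal M p (λ i → c * x i + y i) i k k≢p) (≡.sym (≔-minimal M p y i k k≢p))))

  ≔-commutes : ∀ {m} (M : Matrix Carrier m) {p q} x y → p ≢ q →
    ∀ i k → (M [ p ≔ x ] [ q ≔ y ]) i k ≡ (M [ q ≔ y ] [ p ≔ x ]) i k
  ≔-commutes M {p} {q} x y p≢q i = updateAt-commutes q p (p≢q ∘ ≡.sym) (M i)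

  ≔-column : ∀ {m} (M : Matrix Carrier m) p i k → (M [ p ≔ (λ i → M i p) ]) i k ≡ M i k
  ≔-column M p i = updateAt-id-local p (M i) ≡.refl

  -- With c the column at p and q, and b the column at r, set the adjacent
  -- columns r and q both to b + c: this determinant vanishes, and so does
  -- every term of its expansion except det M.
  det-columns-⋖ : ∀ {m} {p q : Fin m} {M : Matrix Carrier m} → p ⋖ q →
    (∀ i → M i p ≈ M i q) → det M ≈ 0#
  det-columns-⋖ (adjacent a) p≈q = det-adjacent-columns a p≈q
  det-columns-⋖ {m} {p} {q} {M} (step {r} p⋖r a) p≈q = begin
    det M                               ≈⟨ det-cong (λ i k → reflexive (≡.trans
                                             (column-q i k) (≔-column M r i k))) ⟨
    D b c                               ≈⟨ +-identityʳ _ ⟨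
    D b c + 0#                          ≈⟨ +-cong (*-identityˡ _) (same-columns c) ⟨
    1# * D b c + D c c                  ≈⟨ linear-r b c c ⟨
    D b+c c                             ≈⟨ +-identityˡ _ ⟨
    0# + D b+c c                        ≈⟨ +-congʳ (trans (*-identityˡ _) D-b+c-b) ⟨
    1# * D b+c b + D b+c c              ≈⟨ det-≔-linear (M [ r ≔ b+c ]) q 1# b c ⟨
    D b+c b+c                           ≈⟨ same-columns b+c ⟩
    0#                                  ∎
    where
    b c b+c : Fin m → Carrier
    b i = M i r
    c i = M i q
    b+c i = 1# * b i + c i

    r≢q : r ≢ q
    r≢q = <⇒≢ (Adjacent⇒< a)

    D : (Fin m → Carrier) → (Fin m → Carrier) → Carrier
    D x y = det (M [ r ≔ x ] [ q ≔ y ])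

    column-r : ∀ x y i → (M [ r ≔ x ] [ q ≔ y ]) i r ≡ x i
    column-r x y i = ≡.trans (≔-minimal (M [ r ≔ x ]) q y i r r≢q) (≔-updates M r x i)

    column-q : ∀ i k → (M [ r ≔ b ] [ q ≔ c ]) i k ≡ (M [ r ≔ b ]) i k
    column-q i = updateAt-id-local q ((M [ r ≔ b ]) i)
      (≡.sym (≔-minimal M r b i q (r≢q ∘ ≡.sym)))

    same-columns : ∀ x → D x x ≈ 0#
    same-columns x = det-adjacent-columns a λ i →
      reflexive (≡.trans (column-r x x i) (≡.sym (≔-updates (M [ r ≔ x ]) q x i)))

    linear-r : ∀ x y z → D (λ i → 1# * x i + y i) z ≈ 1# * D x z + D y z
    linear-r x y z = begin
      D _ z                                                      ≈⟨ swap _ ⟩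
      det (M [ q ≔ z ] [ r ≔ _ ])                                ≈⟨ det-≔-linear (M [ q ≔ z ]) r 1# x y ⟩
      1# * det (M [ q ≔ z ] [ r ≔ x ]) + det (M [ q ≔ z ] [ r ≔ y ])  ≈⟨ +-cong (*-congˡ (swap x)) (swap y) ⟨
      1# * D x z + D y z                                         ∎
      where
      swap : ∀ v → D v z ≈ det (M [ q ≔ z ] [ r ≔ v ])
      swap v = det-cong λ i k → reflexive (≔-commutes M v z r≢q i k)

    -- Column `r` now holds `c`, which agrees with column `p`; the chain from `p` to `r` is one step
    -- shorter, so the recursive call applies.
    D-c-b : D c b ≈ 0#
    D-c-b = det-columns-⋖ p⋖r λ i → begin
      (M [ r ≔ c ] [ q ≔ b ]) i p  ≡⟨ ≔-minimal (M [ r ≔ c ]) q b i p (<⇒≢ (⋖⇒< (step p⋖r a))) ⟩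
      (M [ r ≔ c ]) i p            ≡⟨ ≔-minimal M r c i p (<⇒≢ (⋖⇒< p⋖r)) ⟩
      M i p                        ≈⟨ p≈q i ⟩
      M i q                        ≡⟨ column-r c b i ⟨
      (M [ r ≔ c ] [ q ≔ b ]) i r  ∎

    D-b+c-b : D b+c b ≈ 0#
    D-b+c-b = begin
      D b+c b             ≈⟨ linear-r b c b ⟩
      1# * D b b + D c b  ≈⟨ +-cong (trans (*-identityˡ _) (same-columns b)) D-c-b ⟩
      0# + 0#             ≈⟨ +-identityˡ 0# ⟩
      0#                  ∎

  det-equal-columns : ∀ {m} {p q : Fin m} {M : Matrix Carrier m} → p ≢ q →
    (∀ i → M i p ≈ M i q) → det M ≈ 0#
  det-equal-columns {p = p} {q} p≢q p≈q with ⋖-total p q p≢q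
  ... | inj₁ p⋖q = det-columns-⋖ p⋖q p≈q
  ... | inj₂ q⋖p = det-columns-⋖ q⋖p (sym ∘ p≈q)

  det-≔-sum : ∀ {m n} (M : Matrix Carrier m) p (c : Fin n → Carrier) (v : Fin n → Fin m → Carrier) →
    det (M [ p ≔ (λ i → sum λ j → c j * v j i) ]) ≈ sum λ j → c j * det (M [ p ≔ v j ])
  det-≔-sum {n = zero}  M p c v = det-zero-column p λ i → reflexive (≔-updates M p (λ _ → 0#) i)
  det-≔-sum {n = suc n} M p c v = trans
    (det-≔-linear M p (c zero) (v zero) (λ i → sum λ j → c (suc j) * v (suc j) i))
    (+-congˡ (det-≔-sum M p (c ∘ suc) (v ∘ suc)))

  -- Cramer's argument: replace column `p` by the combination of all columns with coefficients `ξ`.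
  -- That column is zero, and in the expansion every term but the `p`-th repeats a column. The
  -- factor `ξ p` stays because it may be a zero divisor.
  det-kernel : ∀ {m} (M : Matrix Carrier m) (ξ : Fin m → Carrier) →
    (∀ i → sum (λ j → M i j * ξ j) ≈ 0#) → ∀ p → ξ p * det M ≈ 0#
  det-kernel M ξ Mξ≈0 p = begin
    ξ p * det M
      ≈⟨ *-congˡ (det-cong λ i k → reflexive (≔-column M p i k)) ⟨
    ξ p * det (M [ p ≔ (λ i → M i p) ])
      ≈⟨ sum-single (λ j → ξ j * det (M [ p ≔ (λ i → M i j) ])) p other ⟨
    sum (λ j → ξ j * det (M [ p ≔ (λ i → M i j) ]))
      ≈⟨ det-≔-sum M p ξ (λ j i → M i j) ⟨
    det (M [ p ≔ (λ i → sum λ j → ξ j * M i j) ])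
      ≈⟨ det-zero-column p (λ i → trans (reflexive (≔-updates M p (λ i → sum λ j → ξ j * M i j) i))
           (trans (sum-cong λ j → *-comm (ξ j) (M i j)) (Mξ≈0 i))) ⟩
    0# ∎
    where
    other : ∀ j → j ≢ p → ξ j * det (M [ p ≔ (λ i → M i j) ]) ≈ 0#
    other j j≢p = trans (*-congˡ (det-equal-columns j≢p λ i → reflexive
      (≡.trans (≔-minimal M p (λ i → M i j) i j j≢p) (≡.sym (≔-updates M p (λ i → M i j) i))))) (zeroʳ (ξ j))

-- Reindexing of finite sums and products

module MonoidImages (M : CommutativeMonoid 0ℓ 0ℓ) where
  open CommutativeMonoid M
  open MonoidSums M
  open import Algebra.Definitions.RawMonoid rawMonoid using () renaming (_×_ to infixr 8 _×ᵐ_)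
  open import Relation.Binary.Reasoning.Setoid setoid

  -- One definition for both monoids of a ring: an omitted entry counts as `0#` in a sum and as `1#`
  -- in a product.
  when : {P : Set} → Dec P → Carrier → Carrier
  when P? x = if does P? then x else ε

  when-yes : ∀ {P : Set} (P? : Dec P) {x} → P → when P? x ≈ x
  when-yes (yes _) p = refl
  when-yes (no ¬p) p = contradiction p ¬p

  when-no : ∀ {P : Set} (P? : Dec P) {x} → ¬ P → when P? x ≈ ε
  when-no (yes p) ¬p = contradiction p ¬p
  when-no (no _)  ¬p = refl

  when-∙ : ∀ {P : Set} (P? : Dec P) x y → when P? (x ∙ y) ≈ when P? x ∙ when P? y
  when-∙ (yes _) x y = refl
  when-∙ (no _)  x y = sym (identityˡ ε)

  -- Sum over the graph of `w` in both orders: by injectivity each point of the image has exactly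
  -- one preimage. In multiplicative form this turns a product along a cycle into a product over its
  -- vertex set.
  sum-image : ∀ {n m} (w : Fin n → Fin m) → Injective _≡_ _≡_ w →
    {P : Fin m → Set} (P? : ∀ j → Dec (P j)) → (∀ j → P j ⇔ ∃ λ i → w i ≡ j) →
    ∀ x → sum (x ∘ w) ≈ sum (λ j → when (P? j) (x j))
  sum-image w inj P? P⇔ x = begin
    sum (x ∘ w)
      ≈⟨ sum-cong (λ i → trans
           (sum-single (λ j → when (w i ≟ j) (x j)) (w i) λ j j≢wi → when-no (w i ≟ j) (j≢wi ∘ ≡.sym))
           (when-yes (w i ≟ w i) ≡.refl)) ⟨
    sum (λ i → sum λ j → when (w i ≟ j) (x j))
      ≈⟨ ∑-comm (λ i j → when (w i ≟ j) (x j)) ⟩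
    sum (λ j → sum λ i → when (w i ≟ j) (x j))
      ≈⟨ sum-cong fibre ⟩
    sum (λ j → when (P? j) (x j)) ∎
    where
    fibre : ∀ j → sum (λ i → when (w i ≟ j) (x j)) ≈ when (P? j) (x j)
    fibre j with P? j
    ... | no ¬p = sum-ε λ i → when-no (w i ≟ j) λ wi≡j → ¬p (Equivalence.from (P⇔ j) (i , wi≡j))
    ... | yes p with Equivalence.to (P⇔ j) p
    ...   | i , ≡.refl = trans
      (sum-single (λ k → when (w k ≟ w i) (x (w i))) i λ k k≢i → when-no (w k ≟ w i) (k≢i ∘ inj))
      (when-yes (w i ≟ w i) ≡.refl)

  -- On a closed walk the vertices entered are those left, up to a rotation.
  sum-rotate : ∀ {n} (x : Fin (suc n) → Carrier) → x zero ≈ x (fromℕ n) →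
    sum (x ∘ suc) ≈ sum (x ∘ inject₁)
  sum-rotate {zero}  x eq = refl
  sum-rotate {suc n} x eq = begin
    sum (x ∘ suc)                                ≈⟨ sum-init-last (x ∘ suc) ⟩
    sum (x ∘ suc ∘ inject₁) ∙ x (fromℕ (suc n))  ≈⟨ comm _ _ ⟩
    x (fromℕ (suc n)) ∙ sum (x ∘ suc ∘ inject₁)  ≈⟨ ∙-congʳ eq ⟨
    x zero ∙ sum (x ∘ suc ∘ inject₁)             ∎

  sumOver : {A : Set} → (A → Carrier) → List A → Carrier
  sumOver f []       = ε
  sumOver f (x ∷ xs) = f x ∙ sumOver f xs

  sumOver-cong : ∀ {A : Set} {f g : A → Carrier} → (∀ x → f x ≈ g x) → ∀ xs → sumOver f xs ≈ sumOver g xs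
  sumOver-cong f≈g []       = refl
  sumOver-cong f≈g (x ∷ xs) = ∙-cong (f≈g x) (sumOver-cong f≈g xs)

  sumOver-++ : ∀ {A : Set} (f : A → Carrier) xs ys → sumOver f (xs ++ ys) ≈ sumOver f xs ∙ sumOver f ys
  sumOver-++ f []       ys = sym (identityˡ _)
  sumOver-++ f (x ∷ xs) ys = trans (∙-congˡ (sumOver-++ f xs ys)) (sym (assoc _ _ _))

  sumOver-ε : ∀ {A : Set} {f : A → Carrier} → (∀ x → f x ≈ ε) → ∀ xs → sumOver f xs ≈ ε
  sumOver-ε f≈ε []       = refl
  sumOver-ε f≈ε (x ∷ xs) = trans (∙-cong (f≈ε x) (sumOver-ε f≈ε xs)) (identityˡ ε)

  sumOver-map : ∀ {A B : Set} (f : B → Carrier) (g : A → B) xs → sumOver f (map g xs) ≈ sumOver (f ∘ g) xs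
  sumOver-map f g []       = refl
  sumOver-map f g (x ∷ xs) = ∙-congˡ (sumOver-map f g xs)

  sumOver-tabulate : ∀ {A : Set} {n} (f : A → Carrier) (g : Fin n → A) → sumOver f (tabulate g) ≈ sum (f ∘ g)
  sumOver-tabulate {n = zero}  f g = refl
  sumOver-tabulate {n = suc n} f g = ∙-congˡ (sumOver-tabulate f (g ∘ suc))

  sumOver-cartesian : ∀ {A B C : Set} (f : C → Carrier) (g : A → B → C) xs ys →
    sumOver f (cartesianProductWith g xs ys) ≈ sumOver (λ x → sumOver (λ y → f (g x y)) ys) xs
  sumOver-cartesian f g []       ys = refl
  sumOver-cartesian f g (x ∷ xs) ys = trans (sumOver-++ f (map (g x) ys) _)
    (∙-cong (sumOver-map f (g x) ys) (sumOver-cartesian f g xs ys))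

  sumOver-filter : ∀ {A : Set} {P : A → Set} (P? : U.Decidable P) y xs →
    sumOver (λ x → when (P? x) y) xs ≈ length (filter P? xs) ×ᵐ y
  sumOver-filter P? y []       = refl
  sumOver-filter P? y (x ∷ xs) with P? x
  ... | yes _ = ∙-congˡ (sumOver-filter P? y xs)
  ... | no  _ = trans (identityˡ _) (sumOver-filter P? y xs)

-- Determinants under a homomorphism and a derivation

module DualNumbers (S : RawRing 0ℓ 0ℓ) (R : CommutativeRing 0ℓ 0ℓ) where
  private
    module S = RawRing S
    module SOps = RingOps S
  open CommutativeRing R hiding (zero)
  open RingOps rawRing
  open Determinants R using (det-cong)
  open MonoidSums +-commutativeMonoid using (sum-cong; sum-single)
  open import Relation.Binary.Reasoning.Setoid setoid

  private
    signˢ : ∀ {m} → Fin m → S.Carrier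
    signˢ j = (S.- S.1#) SOps.^ toℕ j

    minorˢ : ∀ {m} → Matrix S.Carrier (suc m) → Fin (suc m) → S.Carrier
    minorˢ M j = SOps.det λ i k → M (suc i) (punchIn j k)

    termˢ : ∀ {m} → Matrix S.Carrier (suc m) → Fin (suc m) → S.Carrier
    termˢ M j = signˢ j S.* M zero j S.* minorˢ M j

  -- The source has operations but no laws, so every computation takes place in the target.
  -- `-1-homo` covers the negation that `det` contains, the one in its signs.
  record Homomorphism : Set where
    field
      ⟦_⟧     : S.Carrier → Carrier
      0-homo  : ⟦ S.0# ⟧ ≈ 0#
      1-homo  : ⟦ S.1# ⟧ ≈ 1#
      -1-homo : ⟦ S.- S.1# ⟧ ≈ - 1#
      +-homo  : ∀ x y → ⟦ x S.+ y ⟧ ≈ ⟦ x ⟧ + ⟦ y ⟧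
      *-homo  : ∀ x y → ⟦ x S.* y ⟧ ≈ ⟦ x ⟧ * ⟦ y ⟧

    sum-homo : ∀ {n} (t : Fin n → S.Carrier) → ⟦ SOps.sum t ⟧ ≈ sum (λ i → ⟦ t i ⟧)
    sum-homo {zero}  t = 0-homo
    sum-homo {suc n} t = trans (+-homo _ _) (+-congˡ (sum-homo (t ∘ suc)))

    sign-homo : ∀ n → ⟦ (S.- S.1#) SOps.^ n ⟧ ≈ (- 1#) ^ n
    sign-homo zero    = 1-homo
    sign-homo (suc n) = trans (*-homo _ _) (*-cong -1-homo (sign-homo n))

    det-homo : ∀ {m} (M : Matrix S.Carrier m) → ⟦ SOps.det M ⟧ ≈ det (λ i j → ⟦ M i j ⟧)
    det-homo {zero}  M = 1-homo
    det-homo {suc m} M = trans (sum-homo (termˢ M)) (sum-cong λ j → begin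
      ⟦ termˢ M j ⟧
        ≈⟨ *-homo (signˢ j S.* M zero j) (minorˢ M j) ⟩
      ⟦ signˢ j S.* M zero j ⟧ * ⟦ minorˢ M j ⟧
        ≈⟨ *-cong (*-homo (signˢ j) (M zero j)) (det-homo λ i k → M (suc i) (punchIn j k)) ⟩
      ⟦ signˢ j ⟧ * ⟦ M zero j ⟧ * det (λ i k → ⟦ M (suc i) (punchIn j k) ⟧)
        ≈⟨ *-congʳ (*-congʳ (sign-homo (toℕ j))) ⟩
      (- 1#) ^ toℕ j * ⟦ M zero j ⟧ * det (λ i k → ⟦ M (suc i) (punchIn j k) ⟧) ∎)

  -- A stand-in for being nonzero that survives multiplication: inverses multiply, while nonzero
  -- elements of a commutative ring may have product zero.
  Unit : Carrier → Set
  Unit x = ∃ λ y → y * x ≈ 1#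

  Unit-cong : ∀ {x y} → x ≈ y → Unit x → Unit y
  Unit-cong x≈y (z , zx≈1) = z , trans (*-congˡ (sym x≈y)) zx≈1

  Unit-1 : Unit 1#
  Unit-1 = 1# , *-identityˡ 1#

  Unit-* : ∀ {x y} → Unit x → Unit y → Unit (x * y)
  Unit-* {x} {y} (a , ax≈1) (b , by≈1) = b * a , (begin
    b * a * (x * y)    ≈⟨ *-assoc b a (x * y) ⟩
    b * (a * (x * y))  ≈⟨ *-congˡ (*-assoc a x y) ⟨
    b * (a * x * y)    ≈⟨ *-congˡ (*-congʳ ax≈1) ⟩
    b * (1# * y)       ≈⟨ *-congˡ (*-identityˡ y) ⟩
    b * y              ≈⟨ by≈1 ⟩
    1#                 ∎)

  -- ⟦_⟧ + ε ∂ is then a homomorphism to the dual numbers.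
  record Derivation (h : Homomorphism) : Set where
    open Homomorphism h
    field
      ∂      : S.Carrier → Carrier
      ∂-0    : ∂ S.0# ≈ 0#
      ∂-1    : ∂ S.1# ≈ 0#
      ∂-+    : ∀ x y → ∂ (x S.+ y) ≈ ∂ x + ∂ y
      ∂-*    : ∀ x y → ∂ (x S.* y) ≈ ∂ x * ⟦ y ⟧ + ⟦ x ⟧ * ∂ y

    ∂-sum : ∀ {n} (t : Fin n → S.Carrier) → ∂ (SOps.sum t) ≈ sum (λ i → ∂ (t i))
    ∂-sum {zero}  t = ∂-0
    ∂-sum {suc n} t = trans (∂-+ _ _) (+-congˡ (∂-sum (t ∘ suc)))

    ⟦*⟧-zeroˡ : ∀ {x} y → ⟦ x ⟧ ≈ 0# → ⟦ x S.* y ⟧ ≈ 0#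
    ⟦*⟧-zeroˡ y x≈0 = trans (*-homo _ _) (trans (*-congʳ x≈0) (zeroˡ _))

    ⟦*⟧-zeroʳ : ∀ x {y} → ⟦ y ⟧ ≈ 0# → ⟦ x S.* y ⟧ ≈ 0#
    ⟦*⟧-zeroʳ x y≈0 = trans (*-homo _ _) (trans (*-congˡ y≈0) (zeroʳ _))

    ∂*-zeroˡ : ∀ {x} y → ⟦ x ⟧ ≈ 0# → ∂ x ≈ 0# → ∂ (x S.* y) ≈ 0#
    ∂*-zeroˡ {x} y x≈0 ∂x≈0 = begin
      ∂ (x S.* y)                ≈⟨ ∂-* x y ⟩
      ∂ x * ⟦ y ⟧ + ⟦ x ⟧ * ∂ y  ≈⟨ +-cong (*-congʳ ∂x≈0) (*-congʳ x≈0) ⟩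
      0# * ⟦ y ⟧ + 0# * ∂ y      ≈⟨ +-cong (zeroˡ _) (zeroˡ _) ⟩
      0# + 0#                    ≈⟨ +-identityˡ 0# ⟩
      0#                         ∎

    ∂*-zeroʳ : ∀ x {y} → ⟦ y ⟧ ≈ 0# → ∂ y ≈ 0# → ∂ (x S.* y) ≈ 0#
    ∂*-zeroʳ x {y} y≈0 ∂y≈0 = begin
      ∂ (x S.* y)                ≈⟨ ∂-* x y ⟩
      ∂ x * ⟦ y ⟧ + ⟦ x ⟧ * ∂ y  ≈⟨ +-cong (*-congˡ y≈0) (*-congˡ ∂y≈0) ⟩
      ∂ x * 0# + ⟦ x ⟧ * 0#      ≈⟨ +-cong (zeroʳ _) (zeroʳ _) ⟩
      0# + 0#                    ≈⟨ +-identityˡ 0# ⟩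
      0#                         ∎

    -- Diagonal only as seen in the dual numbers. For `χ` the off-diagonal entries are constant
    -- polynomials whose scalar parts vanish, though as zeons they can be nonzero.
    record Diagonal {m} (M : Matrix S.Carrier m) : Set where
      field
        value : ∀ i j → i ≢ j → ⟦ M i j ⟧ ≈ 0#
        slope : ∀ i j → i ≢ j → ∂ (M i j) ≈ 0#

    module _ {m} {M : Matrix S.Carrier (suc m)} (diag : Diagonal M) where
      open Diagonal diag

      rest : Matrix S.Carrier m
      rest i k = M (suc i) (suc k)

      rest-diagonal : Diagonal rest
      rest-diagonal = record
        { value = λ i j i≢j → value (suc i) (suc j) λ { ≡.refl → i≢j ≡.refl }
        ; slope = λ i j i≢j → slope (suc i) (suc j) λ { ≡.refl → i≢j ≡.refl }
        }

      private
        -- The sign of column zero computes to `S.1#`, which no law of `S` absorbs; it disappears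
        -- only in the image.
        head-value : ⟦ S.1# S.* M zero zero ⟧ ≈ ⟦ M zero zero ⟧
        head-value = trans (*-homo _ _) (trans (*-congʳ 1-homo) (*-identityˡ _))

        head-slope : ∂ (S.1# S.* M zero zero) ≈ ∂ (M zero zero)
        head-slope = begin
          ∂ (S.1# S.* M zero zero)                            ≈⟨ ∂-* _ _ ⟩
          ∂ S.1# * ⟦ M zero zero ⟧ + ⟦ S.1# ⟧ * ∂ (M zero zero) ≈⟨ +-cong (*-congʳ ∂-1) (*-congʳ 1-homo) ⟩
          0# * ⟦ M zero zero ⟧ + 1# * ∂ (M zero zero)         ≈⟨ +-cong (zeroˡ _) (*-identityˡ _) ⟩
          0# + ∂ (M zero zero)                                ≈⟨ +-identityˡ _ ⟩
          ∂ (M zero zero)                                     ∎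

      value-det : ⟦ SOps.det M ⟧ ≈ ⟦ M zero zero ⟧ * ⟦ SOps.det rest ⟧
      value-det = begin
        ⟦ SOps.det M ⟧                          ≈⟨ sum-homo (termˢ M) ⟩
        sum (λ j → ⟦ termˢ M j ⟧)                  ≈⟨ sum-single _ zero (λ j j≢0 →
          ⟦*⟧-zeroˡ (minorˢ M j) (⟦*⟧-zeroʳ (signˢ j) (value zero j (j≢0 ∘ ≡.sym)))) ⟩
        ⟦ termˢ M zero ⟧                          ≈⟨ trans (*-homo _ _) (*-congʳ head-value) ⟩
        ⟦ M zero zero ⟧ * ⟦ SOps.det rest ⟧     ∎

      slope-det : ∂ (SOps.det M) ≈
        ∂ (M zero zero) * ⟦ SOps.det rest ⟧ + ⟦ M zero zero ⟧ * ∂ (SOps.det rest)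
      slope-det = begin
        ∂ (SOps.det M)                          ≈⟨ ∂-sum (termˢ M) ⟩
        sum (λ j → ∂ (termˢ M j))                  ≈⟨ sum-single _ zero (λ j j≢0 →
          let j≢0′ = j≢0 ∘ ≡.sym in
          ∂*-zeroˡ (minorˢ M j) (⟦*⟧-zeroʳ (signˢ j) (value zero j j≢0′))
                                (∂*-zeroʳ (signˢ j) (value zero j j≢0′) (slope zero j j≢0′))) ⟩
        ∂ (termˢ M zero)                           ≈⟨ ∂-* _ _ ⟩
        _ * _ + _ * _                           ≈⟨ +-cong (*-congʳ head-slope) (*-congʳ head-value) ⟩
        ∂ (M zero zero) * ⟦ SOps.det rest ⟧ + ⟦ M zero zero ⟧ * ∂ (SOps.det rest) ∎

    value-det-unit : ∀ {m} {M : Matrix S.Carrier m} → Diagonal M →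
      (∀ i → Unit ⟦ M i i ⟧) → Unit ⟦ SOps.det M ⟧
    value-det-unit {zero}  diag units = Unit-cong (sym 1-homo) Unit-1
    value-det-unit {suc m} diag units = Unit-cong (sym (value-det diag))
      (Unit-* (units zero) (value-det-unit (rest-diagonal diag) (units ∘ suc)))

    value-det-zero : ∀ {m} {M : Matrix S.Carrier m} → Diagonal M →
      ∀ l → ⟦ M l l ⟧ ≈ 0# → ⟦ SOps.det M ⟧ ≈ 0#
    value-det-zero diag zero    z = trans (value-det diag) (trans (*-congʳ z) (zeroˡ _))
    value-det-zero diag (suc l) z = trans (value-det diag)
      (trans (*-congˡ (value-det-zero (rest-diagonal diag) l z)) (zeroʳ _))

    -- The determinant acts as the product of the diagonal. Since the entry at `l` has value zero,
    -- the product rule leaves only the summand that differentiates this entry: its slope times the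
    -- values of the others.
    slope-det-unit : ∀ {m} {M : Matrix S.Carrier m} → Diagonal M → ∀ l →
      ⟦ M l l ⟧ ≈ 0# → Unit (∂ (M l l)) → (∀ i → i ≢ l → Unit ⟦ M i i ⟧) → Unit (∂ (SOps.det M))
    slope-det-unit {suc m} {M} diag zero z s units =
      Unit-cong (sym (trans (slope-det diag) (trans (+-congˡ (trans (*-congʳ z) (zeroˡ _))) (+-identityʳ _))))
        (Unit-* s (value-det-unit (rest-diagonal diag) λ i → units (suc i) λ ()))
    slope-det-unit {suc m} {M} diag (suc l) z s units =
      Unit-cong (sym (trans (slope-det diag) (trans (+-congʳ
          (trans (*-congˡ (value-det-zero (rest-diagonal diag) l z)) (zeroʳ _))) (+-identityˡ _))))
        (Unit-* (units zero λ ())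
          (slope-det-unit (rest-diagonal diag) l z s λ i i≢l → units (suc i) λ { ≡.refl → i≢l ≡.refl }))

-- Evaluation, division by a linear factor, and derivatives

module PolynomialRoots (R : CommutativeRing 0ℓ 0ℓ) where
  open CommutativeRing R hiding (zero)
  open Polynomials rawRing
  open import Algebra.Properties.Ring ring
  open import Algebra.Properties.Semiring.Sum semiring using (*-distribˡ-sum)
  open import Algebra.Solver.Ring.NaturalCoefficients.Default commutativeSemiring
    using (solve; _:=_; _:+_; _:*_)
  open import Relation.Binary.Reasoning.Setoid setoid

  eval-+ₚ : ∀ p q a → eval (p +ₚ q) a ≈ eval p a + eval q a
  eval-+ₚ []      q       a = sym (+-identityˡ _)
  eval-+ₚ (c ∷ p) []      a = sym (+-identityʳ _)
  eval-+ₚ (c ∷ p) (d ∷ q) a = trans (+-congˡ (*-congˡ (eval-+ₚ p q a)))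
    (solve 5 (λ c d a p q → (c :+ d) :+ a :* (p :+ q) := (c :+ a :* p) :+ (d :+ a :* q)) refl
      c d a (eval p a) (eval q a))

  eval-scale : ∀ c p a → eval (map (c *_) p) a ≈ c * eval p a
  eval-scale c []      a = sym (zeroʳ c)
  eval-scale c (d ∷ p) a = trans (+-congˡ (*-congˡ (eval-scale c p a)))
    (solve 4 (λ c d a p → c :* d :+ a :* (c :* p) := c :* (d :+ a :* p)) refl c d a (eval p a))

  eval-*ₚ : ∀ p q a → eval (p *ₚ q) a ≈ eval p a * eval q a
  eval-*ₚ []      q a = sym (zeroˡ _)
  eval-*ₚ (c ∷ p) q a = begin
    eval (map (c *_) q +ₚ (0# ∷ (p *ₚ q))) a
      ≈⟨ eval-+ₚ (map (c *_) q) _ a ⟩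
    eval (map (c *_) q) a + (0# + a * eval (p *ₚ q) a)
      ≈⟨ +-cong (eval-scale c q a) (trans (+-identityˡ _) (*-congˡ (eval-*ₚ p q a))) ⟩
    c * eval q a + a * (eval p a * eval q a)
      ≈⟨ solve 4 (λ c a p q → c :* q :+ a :* (p :* q) := (c :+ a :* p) :* q) refl c a (eval p a) (eval q a) ⟩
    (c + a * eval p a) * eval q a ∎

  eval-const : ∀ c a → eval (const c) a ≈ c
  eval-const c a = trans (+-congˡ (zeroʳ a)) (+-identityʳ c)

  eval-X : ∀ a → eval X a ≈ a
  eval-X a = trans (+-identityˡ _) (trans (*-congˡ (eval-const 1# a)) (*-identityʳ a))

  -- Synthetic division by `X - a`: the coefficients of the quotient are the Horner values of the
  -- proper tails of the list, the last being a trailing zero.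
  quotient : Poly → Carrier → Poly
  quotient []      a = []
  quotient (c ∷ p) a = eval p a ∷ quotient p a

  coeff-+ₚ : ∀ p q n → coeff (p +ₚ q) n ≈ coeff p n + coeff q n
  coeff-+ₚ []      q       n       = sym (+-identityˡ _)
  coeff-+ₚ (c ∷ p) []      n       = sym (+-identityʳ _)
  coeff-+ₚ (c ∷ p) (d ∷ q) zero    = refl
  coeff-+ₚ (c ∷ p) (d ∷ q) (suc n) = coeff-+ₚ p q n

  coeff-scale : ∀ c p n → coeff (map (c *_) p) n ≈ c * coeff p n
  coeff-scale c []      n       = sym (zeroʳ c)
  coeff-scale c (d ∷ p) zero    = refl
  coeff-scale c (d ∷ p) (suc n) = coeff-scale c p n

  coeff-[0] : ∀ n → coeff (0# ∷ []) n ≈ 0#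
  coeff-[0] zero    = refl
  coeff-[0] (suc n) = refl

  module _ (a : Carrier) where
    coeff-linear-zero : ∀ g → coeff ((X +ₚ const (- a)) *ₚ g) zero ≈ - a * coeff g zero
    coeff-linear-zero g = begin
      coeff ((X +ₚ const (- a)) *ₚ g) zero           ≈⟨ coeff-+ₚ (map ((0# - a) *_) g) _ zero ⟩
      coeff (map ((0# - a) *_) g) zero + 0#          ≈⟨ +-identityʳ _ ⟩
      coeff (map ((0# - a) *_) g) zero               ≈⟨ coeff-scale (0# - a) g zero ⟩
      (0# - a) * coeff g zero                        ≈⟨ *-congʳ (+-identityˡ (- a)) ⟩
      - a * coeff g zero                             ∎

    coeff-linear-suc : ∀ g n →
      coeff ((X +ₚ const (- a)) *ₚ g) (suc n) ≈ - a * coeff g (suc n) + coeff g n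
    coeff-linear-suc g n = begin
      coeff ((X +ₚ const (- a)) *ₚ g) (suc n)
        ≈⟨ coeff-+ₚ (map ((0# - a) *_) g) _ (suc n) ⟩
      coeff (map ((0# - a) *_) g) (suc n) + coeff (map (1# *_) g +ₚ (0# ∷ [])) n
        ≈⟨ +-cong (trans (coeff-scale (0# - a) g (suc n)) (*-congʳ (+-identityˡ (- a))))
                  (coeff-+ₚ (map (1# *_) g) (0# ∷ []) n) ⟩
      - a * coeff g (suc n) + (coeff (map (1# *_) g) n + coeff (0# ∷ []) n)
        ≈⟨ +-congˡ (trans (+-cong (trans (coeff-scale 1# g n) (*-identityˡ _)) (coeff-[0] n)) (+-identityʳ _)) ⟩
      - a * coeff g (suc n) + coeff g n ∎

    cancel : ∀ c x → c ≈ - a * x + (c + a * x)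
    cancel c x = begin
      c                       ≈⟨ +-identityʳ c ⟨
      c + 0#                  ≈⟨ +-congˡ (-‿inverseˡ (a * x)) ⟨
      c + (- (a * x) + a * x) ≈⟨ +-congˡ (+-congʳ (-‿distribˡ-* a x)) ⟩
      c + (- a * x + a * x)   ≈⟨ solve 3 (λ c y z → c :+ (y :+ z) := y :+ (c :+ z)) refl c (- a * x) (a * x) ⟩
      - a * x + (c + a * x)   ∎

    -- This is Horner's recursion `eval (d ∷ p) a = d + a * eval p a` solved for `d`. It holds
    -- whether or not `a` is a root, as the remainder affects only the constant coefficient.
    coeff-quotient : ∀ p n →
      coeff p (suc n) ≈ - a * coeff (quotient p a) (suc n) + coeff (quotient p a) n
    coeff-quotient []          n       = sym (trans (+-identityʳ _) (zeroʳ (- a)))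
    coeff-quotient (c ∷ [])    zero    = sym (trans (+-identityʳ _) (zeroʳ (- a)))
    coeff-quotient (c ∷ d ∷ p) zero    = cancel d (eval p a)
    coeff-quotient (c ∷ p)     (suc n) = coeff-quotient p n

    factor-theorem : ∀ p → eval p a ≈ 0# → p ≈ₚ ((X +ₚ const (- a)) *ₚ quotient p a)
    factor-theorem p       root (suc n) =
      trans (coeff-quotient p n) (sym (coeff-linear-suc (quotient p a) n))
    factor-theorem []      root zero    = sym (trans (coeff-linear-zero []) (zeroʳ (- a)))
    factor-theorem (c ∷ p) root zero    = begin
      c                                         ≈⟨ cancel c (eval p a) ⟩
      - a * eval p a + eval (c ∷ p) a           ≈⟨ +-congˡ root ⟩
      - a * eval p a + 0#                       ≈⟨ +-identityʳ _ ⟩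
      - a * eval p a                            ≈⟨ coeff-linear-zero (quotient (c ∷ p) a) ⟨
      coeff ((X +ₚ const (- a)) *ₚ quotient (c ∷ p) a) zero ∎

    -- From `p = (X - a) q + p(a)`, the value `q(a)` is the formal derivative of `p` at `a`. In this
    -- form it is literally the quantity that `IsSimpleZero` wants to be nonzero when `quotient` is
    -- the witness.
    derivative : Poly → Carrier
    derivative p = eval (quotient p a) a

    derivative-+ₚ : ∀ p q → derivative (p +ₚ q) ≈ derivative p + derivative q
    derivative-+ₚ []      q       = sym (+-identityˡ _)
    derivative-+ₚ (c ∷ p) []      = sym (+-identityʳ _)
    derivative-+ₚ (c ∷ p) (d ∷ q) = trans (+-cong (eval-+ₚ p q a) (*-congˡ (derivative-+ₚ p q)))
      (solve 5 (λ a p q r s → (p :+ q) :+ a :* (r :+ s) := (p :+ a :* r) :+ (q :+ a :* s)) refl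
        a (eval p a) (eval q a) (derivative p) (derivative q))

    derivative-scale : ∀ c p → derivative (map (c *_) p) ≈ c * derivative p
    derivative-scale c []      = sym (zeroʳ c)
    derivative-scale c (d ∷ p) = trans (+-cong (eval-scale c p a) (*-congˡ (derivative-scale c p)))
      (solve 4 (λ a c p r → c :* p :+ a :* (c :* r) := c :* (p :+ a :* r)) refl a c (eval p a) (derivative p))

    derivative-*ₚ : ∀ p q →
      derivative (p *ₚ q) ≈ derivative p * eval q a + eval p a * derivative q
    derivative-*ₚ []      q = sym (trans (+-cong (zeroˡ _) (zeroˡ _)) (+-identityˡ 0#))
    derivative-*ₚ (c ∷ p) q = begin
      derivative (map (c *_) q +ₚ (0# ∷ (p *ₚ q)))
        ≈⟨ derivative-+ₚ (map (c *_) q) _ ⟩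
      derivative (map (c *_) q) + (eval (p *ₚ q) a + a * derivative (p *ₚ q))
        ≈⟨ +-cong (derivative-scale c q) (+-cong (eval-*ₚ p q a) (*-congˡ (derivative-*ₚ p q))) ⟩
      c * derivative q + (eval p a * eval q a + a * (derivative p * eval q a + eval p a * derivative q))
        ≈⟨ solve 6 (λ a c p q r s →
              c :* s :+ (p :* q :+ a :* (r :* q :+ p :* s)) := (p :+ a :* r) :* q :+ (c :+ a :* p) :* s) refl
              a c (eval p a) (eval q a) (derivative p) (derivative q) ⟩
      derivative (c ∷ p) * eval q a + eval (c ∷ p) a * derivative q ∎

  -- The matrix is local to charPoly; the witness found by unification names it.
  charPoly-matrix : ∀ {m} (M : Matrix Carrier m) →
    ∃ λ (P : Matrix Poly m) → charPoly M ≡ RingOps.det polyRawRing P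
  charPoly-matrix M = _ , ≡.refl

  charPoly-entry : ∀ {m} → Matrix Carrier m → Matrix Poly m
  charPoly-entry M = proj₁ (charPoly-matrix M)

  -- A view of the entries, indexed by the polynomial itself, so that later proofs match on it
  -- rather than on the decision inside `charPoly`.
  data Entry {m} (M : Matrix Carrier m) i : Fin m → Poly → Set where
    on  : Entry M i i (X +ₚ const (- M i i))
    off : ∀ {j} → i ≢ j → Entry M i j (const (- M i j))

  entry : ∀ {m} (M : Matrix Carrier m) i j → Entry M i j (charPoly-entry M i j)
  entry M i j with i ≟ j
  ... | yes ≡.refl = on
  ... | no  i≢j    = off i≢j

  evaluation : Carrier → DualNumbers.Homomorphism polyRawRing R
  evaluation a = record
    { ⟦_⟧     = λ p → eval p a
    ; 0-homo  = refl
    ; 1-homo  = eval-const 1# a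
    ; -1-homo = eval-const (- 1#) a
    ; +-homo  = λ p q → eval-+ₚ p q a
    ; *-homo  = λ p q → eval-*ₚ p q a
    }

  open RingOps rawRing using (sum)
  open MonoidSums +-commutativeMonoid using (sum-cong; sum-single; ∑-distrib-+)
  open MonoidImages +-commutativeMonoid using (when; when-yes; when-no)
  open Determinants R using (det-kernel)

  charPoly-value : ∀ {m} (M : Matrix Carrier m) a i j →
    eval (charPoly-entry M i j) a ≈ when (i ≟ j) a - M i j
  charPoly-value M a i j = value (entry M i j)
    where
    value : ∀ {p} → Entry M i j p → eval p a ≈ when (i ≟ j) a - M i j
    value on        = trans (eval-+ₚ X (const (- M i i)) a)
      (+-cong (trans (eval-X a) (sym (when-yes (i ≟ i) ≡.refl))) (eval-const (- M i i) a))
    value (off i≢j) = trans (eval-const (- M i j) a)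
      (sym (trans (+-congʳ (when-no (i ≟ j) i≢j)) (+-identityˡ _)))

  -- Evaluation commutes with `det`, so the value of the characteristic polynomial is the
  -- determinant of the evaluated matrix `μ - M`, which has `ξ` in its kernel.
  eigenvector-annihilates : ∀ {m} (M : Matrix Carrier m) μ (ξ : Fin m → Carrier) →
    (∀ i → sum (λ j → M i j * ξ j) ≈ μ * ξ i) → ∀ p → ξ p * eval (charPoly M) μ ≈ 0#
  eigenvector-annihilates M μ ξ Mξ≈μξ p = trans
    (*-congˡ (DualNumbers.Homomorphism.det-homo (evaluation μ) (charPoly-entry M)))
    (det-kernel (λ i j → eval (charPoly-entry M i j) μ) ξ kernel p)
    where
    kernel : ∀ i → sum (λ j → eval (charPoly-entry M i j) μ * ξ j) ≈ 0#
    kernel i = begin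
      sum (λ j → eval (charPoly-entry M i j) μ * ξ j)
        ≈⟨ sum-cong (λ j → trans (*-congʳ (charPoly-value M μ i j)) (distribʳ (ξ j) _ (- M i j))) ⟩
      sum (λ j → when (i ≟ j) μ * ξ j + - M i j * ξ j)
        ≈⟨ ∑-distrib-+ (λ j → when (i ≟ j) μ * ξ j) (λ j → - M i j * ξ j) ⟩
      sum (λ j → when (i ≟ j) μ * ξ j) + sum (λ j → - M i j * ξ j)
        ≈⟨ +-cong (trans (sum-single (λ j → when (i ≟ j) μ * ξ j) i λ j j≢i →
                      trans (*-congʳ (when-no (i ≟ j) (j≢i ∘ ≡.sym))) (zeroˡ (ξ j)))
                    (*-congʳ (when-yes (i ≟ i) ≡.refl)))
                  (trans (sum-cong λ j → trans (sym (-‿distribˡ-* (M i j) (ξ j))) (sym (-1*x≈-x _)))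
                    (sym (*-distribˡ-sum (- 1#) (λ j → M i j * ξ j)))) ⟩
      μ * ξ i + - 1# * sum (λ j → M i j * ξ j)
        ≈⟨ +-congˡ (trans (-1*x≈-x _) (-‿cong (Mξ≈μξ i))) ⟩
      μ * ξ i - μ * ξ i
        ≈⟨ -‿inverseʳ (μ * ξ i) ⟩
      0# ∎

-- The Neumann series as a sum over walks

allVecs : ∀ m n → List (Vec (Fin m) n)
allVecs m zero    = [] ∷ []
allVecs m (suc n) = cartesianProductWith _∷_ (allFin m) (allVecs m n)

SquaresVanish : (R : CommutativeRing 0ℓ 0ℓ) → ∀ {m} → (Fin m → CommutativeRing.Carrier R) → Set
SquaresVanish R z = ∀ j → z j * z j ≈ 0#
  where open CommutativeRing R

module WalkSums (R : CommutativeRing 0ℓ 0ℓ) {m} (ℓ : Fin m)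
  (z : Fin m → CommutativeRing.Carrier R) (z²≈0 : SquaresVanish R z)
  (δ : Matrix (CommutativeRing.Carrier R) m)
  (d : Fin m → CommutativeRing.Carrier R) (dℓ≈1 : CommutativeRing._≈_ R (d ℓ) (CommutativeRing.1# R)) where

  open CommutativeRing R hiding (zero)
  open RingOps rawRing
  open import Algebra.Properties.Ring ring
  open MonoidSums +-commutativeMonoid using (sum-cong; sum-single; sum-ε; ∑-distrib-+)
  open MonoidImages +-commutativeMonoid
  private
    module Π where
      open MonoidSums *-commutativeMonoid public
      open MonoidImages *-commutativeMonoid public
  open import Algebra.Properties.Semiring.Sum semiring using (*-distribˡ-sum; *-distribʳ-sum)
  open import Algebra.Solver.Ring.NaturalCoefficients.Default commutativeSemiring
    using (solve; _:=_; _:+_; _:*_)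
  open import Relation.Binary.Reasoning.Setoid setoid

  ψ : Matrix Carrier m
  ψ i j = z j * δ i j

  e : Fin m → Carrier
  e i = when (i ≟ ℓ) 1#

  a : Matrix Carrier m
  a i j = - d i * ψ i j

  infixr 8 a·_
  a·_ : (Fin m → Carrier) → Fin m → Carrier
  (a· x) i = sum λ j → a i j * x j

  V : ℕ → Fin m → Carrier
  V zero    = e
  V (suc n) = a· V n

  a·-+ : ∀ x y i → (a· λ j → x j + y j) i ≈ (a· x) i + (a· y) i
  a·-+ x y i = trans (sum-cong λ j → distribˡ (a i j) (x j) (y j))
    (∑-distrib-+ (λ j → a i j * x j) (λ j → a i j * y j))

  weight : ∀ {n} → (Fin (suc n) → Fin m) → Carrier
  weight {n} w = product (λ i → a (w (inject₁ i)) (w (suc i))) * e (w (fromℕ n))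

  -- A power of a matrix sums over walks. All vertex sequences from `i` are listed; those with a
  -- vanishing `δ` or with an end other than `ℓ` contribute zero.
  V-weights : ∀ n i → V n i ≈ sumOver (λ v → weight (lookup (i ∷ v))) (allVecs m n)
  V-weights zero    i = sym (trans (+-identityʳ _) (*-identityˡ (e i)))
  V-weights (suc n) i = begin
    sum (λ j → a i j * V n j)
      ≈⟨ sum-cong (λ j → trans (*-congˡ (V-weights n j)) (scale j (allVecs m n))) ⟩
    sum (λ j → sumOver (λ v → weight (lookup (i ∷ j ∷ v))) (allVecs m n))
      ≈⟨ sumOver-tabulate (λ j → sumOver (λ v → weight (lookup (i ∷ j ∷ v))) (allVecs m n)) (λ j → j) ⟨
    sumOver (λ j → sumOver (λ v → weight (lookup (i ∷ j ∷ v))) (allVecs m n)) (allFin m)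
      ≈⟨ sumOver-cartesian (λ v → weight (lookup (i ∷ v))) _∷_ (allFin m) (allVecs m n) ⟨
    sumOver (λ v → weight (lookup (i ∷ v))) (allVecs m (suc n)) ∎
    where
    scale : ∀ j vs → a i j * sumOver (λ v → weight (lookup (j ∷ v))) vs ≈
                     sumOver (λ v → weight (lookup (i ∷ j ∷ v))) vs
    scale j []       = zeroʳ _
    scale j (v ∷ vs) = trans (distribˡ _ _ _) (+-cong (sym (*-assoc _ _ _)) (scale j vs))

  product-zero : ∀ {n} (t : Fin n → Carrier) i → t i ≈ 0# → product t ≈ 0#
  product-zero {suc n} t i ti≈0 = trans (Π.sum-remove t) (trans (*-congʳ ti≈0) (zeroˡ _))

  product-clash : ∀ {n} (t : Fin n → Carrier) {i j} → i ≢ j → t i * t j ≈ 0# → product t ≈ 0#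
  product-clash {suc n} t {i} {j} i≢j titj≈0 with punchOut i≢j | punchIn-punchOut i≢j
  product-clash {suc (suc n)} t {i} i≢j titj≈0 | k | ≡.refl = begin
    product t                     ≈⟨ Π.sum-remove t ⟩
    t i * product (t ∘ punchIn i) ≈⟨ *-congˡ (Π.sum-remove {i = k} (t ∘ punchIn i)) ⟩
    t i * (t (punchIn i k) * _)   ≈⟨ *-assoc _ _ _ ⟨
    t i * t (punchIn i k) * _     ≈⟨ trans (*-congʳ titj≈0) (zeroˡ _) ⟩
    0#                            ∎

  z-clash : ∀ {n} (w : Fin n → Fin m) {i j} → i ≢ j → w i ≡ w j → ∀ (r : Fin n → Carrier) →
    product (λ k → z (w k) * r k) ≈ 0#
  z-clash w {i} {j} i≢j wi≡wj r = product-clash (λ k → z (w k) * r k) i≢j (begin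
    (z (w i) * r i) * (z (w j) * r j)  ≡⟨ ≡.cong (λ x → (z (w i) * r i) * (z x * r j)) wi≡wj ⟨
    (z (w i) * r i) * (z (w i) * r j)  ≈⟨ solve 3 (λ x y y′ → (x :* y) :* (x :* y′) := (x :* x) :* (y :* y′)) refl
                                            (z (w i)) (r i) (r j) ⟩
    (z (w i) * z (w i)) * (r i * r j)  ≈⟨ trans (*-congʳ (z²≈0 (w i))) (zeroˡ _) ⟩
    0#                                 ∎)

  -- A step carries the generator of the vertex it enters, so the start `w zero` is not among the
  -- positions compared: it may recur once without harm.
  weight-clash : ∀ {n} (w : Fin (suc n) → Fin m) {i j} → i ≢ j → w (suc i) ≡ w (suc j) → weight w ≈ 0#
  weight-clash w i≢j eq = trans (*-congʳ (trans
    (Π.sum-cong λ k → solve 3 (λ d z δ → d :* (z :* δ) := z :* (d :* δ)) refl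
      (- d (w (inject₁ k))) (z (w (suc k))) (δ (w (inject₁ k)) (w (suc k))))
    (z-clash (w ∘ suc) i≢j eq λ k → - d (w (inject₁ k)) * δ (w (inject₁ k)) (w (suc k))))) (zeroˡ _)

  V-vanishes : ∀ i → V (suc m) i ≈ 0#
  V-vanishes i = trans (V-weights (suc m) i) (sumOver-ε clash (allVecs m (suc m)))
    where
    clash : ∀ v → weight (lookup (i ∷ v)) ≈ 0#
    clash v with pigeonhole (n<1+n m) (lookup v)
    ... | j , k , j<k , eq = weight-clash (lookup (i ∷ v)) (<⇒≢ j<k) eq

  weight-open : ∀ {n} (w : Fin (suc n) → Fin m) → w (fromℕ n) ≢ ℓ → weight w ≈ 0#
  weight-open {n} w end≢ℓ = trans (*-congˡ (when-no (w (fromℕ n) ≟ ℓ) end≢ℓ)) (zeroʳ _)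

  weight-broken : ∀ {n} (w : Fin (suc n) → Fin m) i → δ (w (inject₁ i)) (w (suc i)) ≈ 0# → weight w ≈ 0#
  weight-broken w i δ≈0 = trans (*-congʳ (product-zero _ i
    (trans (*-congˡ (trans (*-congˡ δ≈0) (zeroʳ _))) (zeroʳ _)))) (zeroˡ _)

  -- What one vertex contributes to a closed walk: `- d` from the step that leaves it and `z` from
  -- the step that enters it.
  b : Fin m → Carrier
  b j = - d j * z j

  -- Because the ends agree, the generators can be rotated from the vertices entered to the vertices
  -- left, where the factors `- d` already sit. The indices then are the positions that `IsCycleOn`
  -- requires to be distinct.
  weight-closed : ∀ {n} (w : Fin (suc n) → Fin m) → w zero ≡ ℓ → w (fromℕ n) ≡ ℓ →
    weight w ≈ product (b ∘ w ∘ inject₁) * product (λ i → δ (w (inject₁ i)) (w (suc i)))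
  weight-closed {n} w start end = begin
    product (λ i → - d (w (inject₁ i)) * (z (w (suc i)) * δ′ i)) * e (w (fromℕ n))
      ≈⟨ trans (*-congˡ (when-yes (w (fromℕ n) ≟ ℓ) end)) (*-identityʳ _) ⟩
    product (λ i → - d (w (inject₁ i)) * (z (w (suc i)) * δ′ i))
      ≈⟨ Π.∑-distrib-+ (λ i → - d (w (inject₁ i))) (λ i → z (w (suc i)) * δ′ i) ⟩
    product (λ i → - d (w (inject₁ i))) * product (λ i → z (w (suc i)) * δ′ i)
      ≈⟨ *-congˡ (Π.∑-distrib-+ (λ i → z (w (suc i))) δ′) ⟩
    product (λ i → - d (w (inject₁ i))) * (product (λ i → z (w (suc i))) * product δ′)
      ≈⟨ *-congˡ (*-congʳ (Π.sum-rotate (z ∘ w) (reflexive (≡.cong z (≡.trans start (≡.sym end)))))) ⟩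
    product (λ i → - d (w (inject₁ i))) * (product (λ i → z (w (inject₁ i))) * product δ′)
      ≈⟨ *-assoc _ _ _ ⟨
    product (λ i → - d (w (inject₁ i))) * product (λ i → z (w (inject₁ i))) * product δ′
      ≈⟨ *-congʳ (Π.∑-distrib-+ (λ i → - d (w (inject₁ i))) (λ i → z (w (inject₁ i)))) ⟨
    product (b ∘ w ∘ inject₁) * product δ′ ∎
    where
    δ′ : Fin n → Carrier
    δ′ i = δ (w (inject₁ i)) (w (suc i))

  weight-closed-clash : ∀ {n} (w : Fin (suc n) → Fin m) → w zero ≡ ℓ → w (fromℕ n) ≡ ℓ →
    ∀ {i j} → i ≢ j → w (inject₁ i) ≡ w (inject₁ j) → weight w ≈ 0#
  weight-closed-clash w start end i≢j eq = trans (weight-closed w start end) (trans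
    (*-congʳ (trans (Π.sum-cong λ k → *-comm (- d (w (inject₁ k))) (z (w (inject₁ k))))
      (z-clash (w ∘ inject₁) i≢j eq λ k → - d (w (inject₁ k))))) (zeroˡ _))

  -- Partial sums of the series without the initial term `e`, so that everything collected here is a
  -- multiple of `z ℓ`.
  Q : ℕ → Fin m → Carrier
  Q zero    i = 0#
  Q (suc n) i = Q n i + V (suc n) i

  Q-step : ∀ n i → (a· λ j → e j + Q n j) i ≈ Q (suc n) i
  Q-step zero    i = trans (sum-cong λ j → *-congˡ (+-identityʳ (e j))) (sym (+-identityˡ _))
  Q-step (suc n) i = begin
    (a· λ j → e j + (Q n j + V (suc n) j)) i          ≈⟨ sum-cong (λ j → *-congˡ (+-assoc (e j) (Q n j) (V (suc n) j))) ⟨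
    (a· λ j → (e j + Q n j) + V (suc n) j) i          ≈⟨ a·-+ (λ j → e j + Q n j) (V (suc n)) i ⟩
    (a· λ j → e j + Q n j) i + V (suc (suc n)) i      ≈⟨ +-congʳ (Q-step n i) ⟩
    Q (suc n) i + V (suc (suc n)) i                   ∎

  y : Fin m → Carrier
  y i = e i + Q m i

  -- The fixed-point equation `y = e + a y`: applying `a` shifts the series by one, and the surplus
  -- term `V (suc m)` vanishes.
  a·y : ∀ i → (a· y) i ≈ Q m i
  a·y i = trans (Q-step m i) (trans (+-congˡ (V-vanishes i)) (+-identityʳ _))

  Multiple : Carrier → Set
  Multiple x = ∃ λ r → x ≈ z ℓ * r

  Multiple-0 : ∀ {x} → x ≈ 0# → Multiple x
  Multiple-0 x≈0 = 0# , trans x≈0 (sym (zeroʳ _))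

  Multiple-+ : ∀ {x y} → Multiple x → Multiple y → Multiple (x + y)
  Multiple-+ (r , x≈) (s , y≈) = r + s , trans (+-cong x≈ y≈) (sym (distribˡ _ r s))

  Multiple-* : ∀ c {x} → Multiple x → Multiple (c * x)
  Multiple-* c {x} (r , x≈) = c * r , trans (*-congˡ x≈)
    (solve 3 (λ c z r → c :* (z :* r) := z :* (c :* r)) refl c (z ℓ) r)

  Multiple-sum : ∀ {n} (t : Fin n → Carrier) → (∀ i → Multiple (t i)) → Multiple (sum t)
  Multiple-sum {zero}  t mult = Multiple-0 refl
  Multiple-sum {suc n} t mult = Multiple-+ (mult zero) (Multiple-sum (t ∘ suc) (mult ∘ suc))

  Multiple-orthogonal : ∀ {x y} → Multiple x → Multiple y → x * y ≈ 0#
  Multiple-orthogonal {x} {y} (r , x≈) (s , y≈) = begin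
    x * y                  ≈⟨ *-cong x≈ y≈ ⟩
    (z ℓ * r) * (z ℓ * s)  ≈⟨ solve 3 (λ z r s → (z :* r) :* (z :* s) := (z :* z) :* (r :* s)) refl (z ℓ) r s ⟩
    (z ℓ * z ℓ) * (r * s)  ≈⟨ trans (*-congʳ (z²≈0 ℓ)) (zeroˡ _) ⟩
    0#                     ∎

  -- The last step of a contributing walk enters `ℓ`. That step is the base case; prepending further
  -- steps only multiplies and adds.
  V-Multiple : ∀ n i → Multiple (V (suc n) i)
  V-Multiple (suc n) i = Multiple-sum (λ j → a i j * V (suc n) j) λ j → Multiple-* (a i j) (V-Multiple n j)
  V-Multiple zero    i = Multiple-sum (λ j → a i j * e j) last
    where
    last : ∀ j → Multiple (a i j * e j)
    last j with j ≟ ℓ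
    ... | yes ≡.refl = - d i * δ i ℓ , trans (*-identityʳ _)
      (solve 3 (λ d z δ → d :* (z :* δ) := z :* (d :* δ)) refl (- d i) (z ℓ) (δ i ℓ))
    ... | no _ = Multiple-0 (zeroʳ _)

  Q-Multiple : ∀ n i → Multiple (Q n i)
  Q-Multiple zero    i = Multiple-0 refl
  Q-Multiple (suc n) i = Multiple-+ (Q-Multiple n i) (V-Multiple n i)

  a·-scale : ∀ x i → (a· x) i ≈ - d i * sum (λ j → ψ i j * x j)
  a·-scale x i = trans (sum-cong λ j → *-assoc (- d i) (ψ i j) (x j))
    (sym (*-distribˡ-sum (- d i) (λ j → ψ i j * x j)))

  yℓ≈ : y ℓ ≈ 1# + Q m ℓ
  yℓ≈ = +-congʳ (when-yes (ℓ ≟ ℓ) ≡.refl)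

  y-off : ∀ i → i ≢ ℓ → y i ≈ Q m i
  y-off i i≢ℓ = trans (+-congʳ (when-no (i ≟ ℓ) i≢ℓ)) (+-identityˡ _)

  -- Multiples of z ℓ annihilate each other, so Q m ℓ * y i ≈ 0# for i ≢ ℓ,
  -- and Q m ℓ * y ℓ ≈ Q m ℓ.
  y-eigen : (φ : Fin m → Carrier) → (∀ i → i ≢ ℓ → d i * (φ ℓ - φ i) ≈ 1#) →
    ∀ i → φ i * y i - sum (λ j → ψ i j * y j) ≈ (φ ℓ + Q m ℓ) * y i
  y-eigen φ inverse i = eigen-at (i ≟ ℓ)
    where
    S : Carrier
    S = sum (λ j → ψ i j * y j)

    Qi≈ : Q m i ≈ - d i * S
    Qi≈ = trans (sym (a·y i)) (a·-scale y i)

    eigen-at : Dec (i ≡ ℓ) → φ i * y i - S ≈ (φ ℓ + Q m ℓ) * y i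
    eigen-at (yes ≡.refl) = begin
      φ i * y i - S
        -- By `dℓ≈1`, row `ℓ` of the fixed-point equation says that `- S` is the correction `Q m ℓ`
        -- itself.
        ≈⟨ +-congˡ (trans (sym (-1*x≈-x S)) (trans (*-congʳ (-‿cong (sym dℓ≈1))) (sym Qi≈))) ⟩
      φ i * y i + Q m i
        ≈⟨ +-congˡ (trans (+-identityʳ _) (*-identityʳ (Q m i))) ⟨
      φ i * y i + (Q m i * 1# + 0#)
        ≈⟨ +-congˡ (+-congˡ (Multiple-orthogonal (Q-Multiple m i) (Q-Multiple m i))) ⟨
      φ i * y i + (Q m i * 1# + Q m i * Q m i)
        ≈⟨ +-congˡ (trans (*-congˡ yℓ≈) (distribˡ (Q m i) 1# (Q m i))) ⟨
      φ i * y i + Q m i * y i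
        ≈⟨ distribʳ (y i) (φ i) (Q m i) ⟨
      (φ i + Q m i) * y i ∎
    eigen-at (no i≢ℓ) = begin
      φ i * y i - S
        ≈⟨ +-congˡ -S≈ ⟩
      φ i * y i + (φ ℓ - φ i) * y i
        ≈⟨ distribʳ (y i) (φ i) (φ ℓ - φ i) ⟨
      (φ i + (φ ℓ - φ i)) * y i
        ≈⟨ *-congʳ (trans (sym (+-assoc _ _ _)) (trans (+-congʳ (+-comm (φ i) (φ ℓ))) (trans (+-assoc _ _ _)
             (trans (+-congˡ (-‿inverseʳ (φ i))) (+-identityʳ (φ ℓ)))))) ⟩
      φ ℓ * y i
        ≈⟨ +-identityʳ _ ⟨
      φ ℓ * y i + 0#
        ≈⟨ +-congˡ (trans (*-congˡ (y-off i i≢ℓ)) (Multiple-orthogonal (Q-Multiple m ℓ) (Q-Multiple m i))) ⟨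
      φ ℓ * y i + Q m ℓ * y i
        ≈⟨ distribʳ (y i) (φ ℓ) (Q m ℓ) ⟨
      (φ ℓ + Q m ℓ) * y i ∎
      where
      -- Row `i` of the fixed-point equation, multiplied by `φ ℓ - φ i` to cancel `d i`.
      -S≈ : - S ≈ (φ ℓ - φ i) * y i
      -S≈ = begin
        - S                                ≈⟨ *-identityˡ (- S) ⟨
        1# * - S                           ≈⟨ *-congʳ (inverse i i≢ℓ) ⟨
        d i * (φ ℓ - φ i) * - S            ≈⟨ *-congʳ (*-comm (d i) (φ ℓ - φ i)) ⟩
        (φ ℓ - φ i) * d i * - S            ≈⟨ *-assoc (φ ℓ - φ i) (d i) (- S) ⟩
        (φ ℓ - φ i) * (d i * - S)          ≈⟨ *-congˡ (trans (sym (-‿distribʳ-* (d i) S)) (-‿distribˡ-* (d i) S)) ⟩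
        (φ ℓ - φ i) * (- d i * S)          ≈⟨ *-congˡ (trans (y-off i i≢ℓ) Qi≈) ⟨
        (φ ℓ - φ i) * y i                  ∎

-- Sums over subsets

module SubsetSums (R : CommutativeRing 0ℓ 0ℓ) where
  open CommutativeRing R hiding (zero)
  open RingOps rawRing
  open MonoidImages +-commutativeMonoid using (sumOver)
  open import Algebra.Properties.CommutativeSemigroup +-commutativeSemigroup using (interchange)

  sumSubsets-cong : ∀ {m} {F H : Subset m → Carrier} → (∀ I → F I ≈ H I) → sumSubsets F ≈ sumSubsets H
  sumSubsets-cong {zero}  F≈H = F≈H []
  sumSubsets-cong {suc m} F≈H =
    +-cong (sumSubsets-cong (F≈H ∘ (outside ∷_))) (sumSubsets-cong (F≈H ∘ (inside ∷_)))

  sumSubsets-0 : ∀ {m} {F : Subset m → Carrier} → (∀ I → F I ≈ 0#) → sumSubsets F ≈ 0#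
  sumSubsets-0 {zero}  F≈0 = F≈0 []
  sumSubsets-0 {suc m} F≈0 = trans
    (+-cong (sumSubsets-0 (F≈0 ∘ (outside ∷_))) (sumSubsets-0 (F≈0 ∘ (inside ∷_)))) (+-identityˡ 0#)

  sumSubsets-+ : ∀ {m} (F H : Subset m → Carrier) →
    sumSubsets (λ I → F I + H I) ≈ sumSubsets F + sumSubsets H
  sumSubsets-+ {zero}  F H = refl
  sumSubsets-+ {suc m} F H = trans
    (+-cong (sumSubsets-+ (F ∘ (outside ∷_)) (H ∘ (outside ∷_))) (sumSubsets-+ (F ∘ (inside ∷_)) (H ∘ (inside ∷_))))
    (interchange _ _ _ _)

  sumSubsets-single : ∀ {m} (F : Subset m → Carrier) I →
    (∀ J → J ≢ I → F J ≈ 0#) → sumSubsets F ≈ F I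
  sumSubsets-single F []            other = refl
  sumSubsets-single F (outside ∷ I) other = trans
    (+-cong (sumSubsets-single (F ∘ (outside ∷_)) I λ J J≢I → other (outside ∷ J) λ { ≡.refl → J≢I ≡.refl })
            (sumSubsets-0 λ J → other (inside ∷ J) λ ()))
    (+-identityʳ _)
  sumSubsets-single F (inside ∷ I) other = trans
    (+-cong (sumSubsets-0 λ J → other (outside ∷ J) λ ())
            (sumSubsets-single (F ∘ (inside ∷_)) I λ J J≢I → other (inside ∷ J) λ { ≡.refl → J≢I ≡.refl }))
    (+-identityˡ _)

  sumOver-sumSubsets : ∀ {m} {A : Set} (F : A → Subset m → Carrier) xs →
    sumOver (λ x → sumSubsets (F x)) xs ≈ sumSubsets (λ I → sumOver (λ x → F x I) xs)
  sumOver-sumSubsets {m} F []       = sym (sumSubsets-0 {m} {F = λ I → 0#} λ _ → refl)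
  sumOver-sumSubsets F (x ∷ xs) = trans (+-congˡ (sumOver-sumSubsets F xs))
    (sym (sumSubsets-+ (F x) (λ I → sumOver (λ x → F x I) xs)))

-- Deciding and enumerating cycles

imageSet : ∀ {n m} → (Fin n → Fin m) → Subset m
imageSet w = Vec.tabulate λ j → does (any? λ i → w i ≟ j)

∈-imageSet : ∀ {n m} (w : Fin n → Fin m) j → j ∈ imageSet w ⇔ ∃ λ i → w i ≡ j
∈-imageSet w j = mk⇔ to from
  where
  lookup-imageSet : lookup (imageSet w) j ≡ does (any? λ i → w i ≟ j)
  lookup-imageSet = Vec.lookup∘tabulate _ j

  to : j ∈ imageSet w → ∃ λ i → w i ≡ j
  to j∈ with any? (λ i → w i ≟ j) | ≡.trans (≡.sym (Vec.[]=⇒lookup j∈)) lookup-imageSet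
  ... | yes p | _ = p

  from : (∃ λ i → w i ≡ j) → j ∈ imageSet w
  from p = Vec.lookup⇒[]= j (imageSet w) (≡.trans lookup-imageSet found)
    where
    found : does (any? λ i → w i ≟ j) ≡ inside
    found with any? (λ i → w i ≟ j)
    ... | yes _ = ≡.refl
    ... | no ¬p = contradiction p ¬p

allVecs-Unique : ∀ m n → Unique (allVecs m n)
allVecs-Unique m zero    = [] ∷ []
allVecs-Unique m (suc n) = cartesianProductWith⁺ _∷_
  (λ { ≡.refl → ≡.refl , ≡.refl }) (allFin⁺ m) (allVecs-Unique m n)

∈-allVecs : ∀ {m n} (v : Vec (Fin m) n) → v List.∈ allVecs m n
∈-allVecs []      = here ≡.refl
∈-allVecs (x ∷ v) = ∈-cartesianProductWith⁺ _∷_ (∈-allFin x) (∈-allVecs v)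

module Cycles {m} (G : SimpleGraph m) (ℓ : Fin m) where
  Cycle : Subset m → VertexSeq m → Set
  Cycle = IsCycleOn G ℓ

  cycle-unique : ∀ {I J c} → Cycle I c → Cycle J c → I ≡ J
  cycle-unique C D = ⊆-antisym
    (λ {j} j∈I → Equivalence.from (IsCycleOn.vertices D j) (Equivalence.to (IsCycleOn.vertices C j) j∈I))
    (λ {j} j∈J → Equivalence.from (IsCycleOn.vertices C j) (Equivalence.to (IsCycleOn.vertices D j) j∈J))

  -- Each reason for not being a cycle is to double as a reason for weight zero. For that purpose
  -- `clash` records that the walk is closed: only then does a repetition involving the starting
  -- vertex repeat a generator.
  data Failure {k} (w : Fin (suc k) → Fin m) : Set where
    trivial : k ≡ 0 → Failure w
    start≢  : w zero ≢ ℓ → Failure w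
    end≢    : w (fromℕ k) ≢ ℓ → Failure w
    broken  : ∀ i → ¬ Adj G (w (inject₁ i)) (w (suc i)) → Failure w
    clash   : w zero ≡ ℓ → w (fromℕ k) ≡ ℓ → ∀ {i j} → i ≢ j → w (inject₁ i) ≡ w (inject₁ j) → Failure w

  failure : ∀ {I k} {v : Vec (Fin m) (suc k)} → Failure (lookup v) → ¬ Cycle I (k , v)
  failure (trivial ≡.refl)      C with () ← IsCycleOn.nontrivial C
  failure (start≢ w₀≢ℓ)         C = w₀≢ℓ (IsCycleOn.starts C)
  failure (end≢ wₖ≢ℓ)           C = wₖ≢ℓ (IsCycleOn.ends C)
  failure (broken i ¬adj)       C = ¬adj (IsCycleOn.adjacent C i)
  failure (clash _ _ i≢j wi≡wj) C = i≢j (IsCycleOn.distinct C wi≡wj)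

  classify : ∀ {k} (v : Vec (Fin m) (suc k)) →
    (∃ λ I → Cycle I (k , v)) ⊎ Failure (lookup v)
  classify {zero}  v = inj₂ (trivial ≡.refl)
  classify {suc k} v with lookup v zero ≟ ℓ | lookup v (fromℕ (suc k)) ≟ ℓ
    | all? (λ i → adj? G (lookup v (inject₁ i)) (lookup v (suc i)))
    | any? (λ i → any? λ j → ¬? (i ≟ j) ×-dec lookup v (inject₁ i) ≟ lookup v (inject₁ j))
  ... | no w₀≢ℓ | _ | _ | _ = inj₂ (start≢ w₀≢ℓ)
  ... | yes _ | no wₖ≢ℓ | _ | _ = inj₂ (end≢ wₖ≢ℓ)
  ... | yes _ | yes _ | no ¬adj | _
    with ¬∀⟶∃¬ _ _ (λ i → adj? G (lookup v (inject₁ i)) (lookup v (suc i))) ¬adj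
  ...   | i , ¬adjᵢ = inj₂ (broken i ¬adjᵢ)
  classify {suc k} v | yes w₀≡ℓ | yes wₖ≡ℓ | yes _ | yes (i , j , i≢j , wi≡wj) =
    inj₂ (clash w₀≡ℓ wₖ≡ℓ i≢j wi≡wj)
  classify {suc k} v | yes w₀≡ℓ | yes wₖ≡ℓ | yes adj | no ¬clash = inj₁ (imageSet (lookup v ∘ inject₁) , record
    { nontrivial = s≤s z≤n
    ; starts     = w₀≡ℓ
    ; ends       = wₖ≡ℓ
    ; adjacent   = adj
    ; distinct   = λ {i} {j} wi≡wj → distinct wi≡wj (i ≟ j)
    ; vertices   = ∈-imageSet (lookup v ∘ inject₁)
    })
    where
    distinct : ∀ {i j} → lookup v (inject₁ i) ≡ lookup v (inject₁ j) → Dec (i ≡ j) → i ≡ j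
    distinct wi≡wj (yes i≡j) = i≡j
    distinct wi≡wj (no i≢j)  = contradiction (_ , _ , i≢j , wi≡wj) ¬clash

  cycle? : ∀ I c → Dec (Cycle I c)
  cycle? I (k , v) with classify v
  ... | inj₂ f = no (failure f)
  ... | inj₁ (J , C) with Vec.≡-dec _≟ᵇ_ J I
  ...   | yes ≡.refl = yes C
  ...   | no J≢I     = no λ D → J≢I (cycle-unique C D)

  -- Sequences from `ℓ` with 1 to `n` steps; their return to `ℓ` is left to the later filter. The
  -- recursion copies that of `Q`, which allows the two to be matched by induction.
  closedSeqs : ℕ → List (VertexSeq m)
  closedSeqs zero    = []
  closedSeqs (suc n) = closedSeqs n ++ map (λ v → suc n , ℓ ∷ v) (allVecs m (suc n))

  closedSeqs-length : ∀ n {c} → c List.∈ closedSeqs n → proj₁ c ≤ n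
  closedSeqs-length (suc n) c∈ with ∈-++⁻ (closedSeqs n) c∈
  ... | inj₁ c∈′ = m≤n⇒m≤1+n (closedSeqs-length n c∈′)
  ... | inj₂ c∈′ with ∈-map⁻ (λ v → suc n , ℓ ∷ v) c∈′
  ...   | _ , _ , ≡.refl = ≤-refl

  closedSeqs-Unique : ∀ n → Unique (closedSeqs n)
  closedSeqs-Unique zero    = []
  closedSeqs-Unique (suc n) = ++⁺ (closedSeqs-Unique n)
    (map⁺ (λ { ≡.refl → ≡.refl }) (allVecs-Unique m (suc n))) disjoint
    where
    disjoint : ∀ {c} → c List.∈ closedSeqs n × c List.∈ map (λ v → suc n , ℓ ∷ v) (allVecs m (suc n)) → ⊥
    disjoint (c∈ , c∈′) with ∈-map⁻ (λ v → suc n , ℓ ∷ v) c∈′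
    ... | _ , _ , ≡.refl = 1+n≰n (closedSeqs-length n c∈)

  ∈-closedSeqs : ∀ n {k} (v : Vec (Fin m) (suc k)) → suc k ≤ n → (suc k , ℓ ∷ v) List.∈ closedSeqs n
  ∈-closedSeqs (suc n) v k<n with m≤n⇒m<n∨m≡n k<n
  ... | inj₁ k<n′   = ∈-++⁺ˡ (∈-closedSeqs n v (≤-pred k<n′))
  ... | inj₂ ≡.refl = ∈-++⁺ʳ (closedSeqs n) (∈-map⁺ (λ v → suc n , ℓ ∷ v) (∈-allVecs v))

  cyclesOn : Subset m → List (VertexSeq m)
  cyclesOn I = filter (cycle? I) (closedSeqs m)

  -- A cycle with `k` steps has `k` distinct vertices, so `k ≤ m`. The bound on the enumeration is
  -- thus the order at which the series is cut off.
  cycle∈closedSeqs : ∀ {I c} → Cycle I c → c List.∈ closedSeqs m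
  cycle∈closedSeqs {c = zero , v} C with () ← IsCycleOn.nontrivial C
  cycle∈closedSeqs {c = suc k , x ∷ v} C with IsCycleOn.starts C
  ... | ≡.refl = ∈-closedSeqs m v (injective⇒≤ (IsCycleOn.distinct C))

  cyclesOn-count : ∀ I → HasCount (Cycle I) (length (cyclesOn I))
  cyclesOn-count I = cyclesOn I , filter⁺ (cycle? I) (closedSeqs-Unique m) ,
    (λ c → mk⇔ (proj₂ ∘ ∈-filter⁻ (cycle? I) {xs = closedSeqs m}) (λ C → ∈-filter⁺ (cycle? I) (cycle∈closedSeqs C) C)) , ≡.refl

-- From walk weights to cycle counts

module CycleWeights (R : CommutativeRing 0ℓ 0ℓ) {m} (G : SimpleGraph m) (ℓ : Fin m)
  (z : Fin m → CommutativeRing.Carrier R) (z²≈0 : SquaresVanish R z)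
  (d : Fin m → CommutativeRing.Carrier R) (dℓ≈1 : CommutativeRing._≈_ R (d ℓ) (CommutativeRing.1# R)) where

  open CommutativeRing R hiding (zero)
  open RingOps rawRing
  open MonoidImages +-commutativeMonoid
  open import Algebra.Definitions.RawMonoid +-rawMonoid using () renaming (_×_ to infixr 8 _×ᵐ_)
  private
    module Π where
      open MonoidSums *-commutativeMonoid public
      open MonoidImages *-commutativeMonoid public
  open import Algebra.Properties.Ring ring using (-1*x≈-x)
  open SubsetSums R
  open Cycles G ℓ
  open import Relation.Binary.Reasoning.Setoid setoid

  adjacency : Fin m → Fin m → Carrier
  adjacency i j = when (adj? G i j) 1#

  open WalkSums R ℓ z z²≈0 adjacency d dℓ≈1 public

  cycleTerm : Subset m → Carrier
  cycleTerm I = product λ j → Π.when (j ∈? I) (b j)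

  -- Neither the order nor the orientation of the vertices matters to the product, so all cycles on
  -- the same `I` have one weight and only their number remains.
  weight-cycle : ∀ {I k} (v : Vec (Fin m) (suc k)) → Cycle I (k , v) → weight (lookup v) ≈ cycleTerm I
  weight-cycle {I} {k} v C = begin
    weight w
      ≈⟨ weight-closed w (IsCycleOn.starts C) (IsCycleOn.ends C) ⟩
    product (b ∘ w ∘ inject₁) * product (λ i → adjacency (w (inject₁ i)) (w (suc i)))
      ≈⟨ *-cong (Π.sum-image (w ∘ inject₁) (IsCycleOn.distinct C) (_∈? I) (IsCycleOn.vertices C) b)
                (Π.sum-ε λ i → when-yes (adj? G _ _) (IsCycleOn.adjacent C i)) ⟩
    cycleTerm I * 1#
      ≈⟨ *-identityʳ _ ⟩
    cycleTerm I ∎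
    where
    w : Fin (suc k) → Fin m
    w = lookup v

  -- Every failure makes some factor vanish or repeats a generator. The case `trivial` is excluded
  -- by the type, since `w` has at least one step.
  weight-failure : ∀ {k} (w : Fin (suc (suc k)) → Fin m) → w zero ≡ ℓ → Failure w → weight w ≈ 0#
  weight-failure w start (start≢ start≢ℓ)           = contradiction start start≢ℓ
  weight-failure w start (end≢ end≢ℓ)               = weight-open w end≢ℓ
  weight-failure w start (broken i ¬adj)            = weight-broken w i (when-no (adj? G _ _) ¬adj)
  weight-failure w start (clash start′ end i≢j eq)  = weight-closed-clash w start′ end i≢j eq

  weightSeq : VertexSeq m → Carrier
  weightSeq (k , v) = weight (lookup v)

  -- A sequence is a cycle on at most one `I`, so this sum has at most one nonzero term. It is
  -- introduced in order to exchange the sum over sequences with the sum over subsets and then count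
  -- for each `I`.
  weight-expand : ∀ {k} (v : Vec (Fin m) (suc k)) → let c = suc k , ℓ ∷ v in
    weightSeq c ≈ sumSubsets λ I → when (cycle? I c) (cycleTerm I)
  weight-expand {k} v = expand (classify (ℓ ∷ v))
    where
    c = suc k , ℓ ∷ v

    expand : (∃ λ I → Cycle I c) ⊎ Failure (lookup (ℓ ∷ v)) →
      weightSeq c ≈ sumSubsets λ I → when (cycle? I c) (cycleTerm I)
    expand (inj₂ f)       = trans (weight-failure (lookup (ℓ ∷ v)) ≡.refl f)
      (sym (sumSubsets-0 λ I → when-no (cycle? I c) (failure f)))
    expand (inj₁ (I , C)) = trans (weight-cycle (ℓ ∷ v) C) (sym (trans
      (sumSubsets-single (λ J → when (cycle? J c) (cycleTerm J)) I λ J J≢I →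
        when-no (cycle? J c) λ D → J≢I (cycle-unique D C))
      (when-yes (cycle? I c) C)))

  Q-expand : ∀ n → Q n ℓ ≈ sumOver (λ c → sumSubsets λ I → when (cycle? I c) (cycleTerm I)) (closedSeqs n)
  Q-expand zero    = refl
  Q-expand (suc n) = begin
    Q n ℓ + V (suc n) ℓ
      ≈⟨ +-cong (Q-expand n) (V-weights (suc n) ℓ) ⟩
    sumOver F (closedSeqs n) + sumOver (λ v → weight (lookup (ℓ ∷ v))) (allVecs m (suc n))
      ≈⟨ +-congˡ (sumOver-cong weight-expand (allVecs m (suc n))) ⟩
    sumOver F (closedSeqs n) + sumOver (λ v → F (suc n , ℓ ∷ v)) (allVecs m (suc n))
      ≈⟨ +-congˡ (sumOver-map F (λ v → suc n , ℓ ∷ v) (allVecs m (suc n))) ⟨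
    sumOver F (closedSeqs n) + sumOver F (map (λ v → suc n , ℓ ∷ v) (allVecs m (suc n)))
      ≈⟨ sumOver-++ F (closedSeqs n) _ ⟨
    sumOver F (closedSeqs (suc n)) ∎
    where
    F : VertexSeq m → Carrier
    F c = sumSubsets λ I → when (cycle? I c) (cycleTerm I)

  Q-cycles : Q m ℓ ≈ sumSubsets λ I → length (cyclesOn I) ×ᵐ cycleTerm I
  Q-cycles = begin
    Q m ℓ
      ≈⟨ Q-expand m ⟩
    sumOver (λ c → sumSubsets λ I → when (cycle? I c) (cycleTerm I)) (closedSeqs m)
      ≈⟨ sumOver-sumSubsets (λ c I → when (cycle? I c) (cycleTerm I)) (closedSeqs m) ⟩
    sumSubsets (λ I → sumOver (λ c → when (cycle? I c) (cycleTerm I)) (closedSeqs m))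
      ≈⟨ sumSubsets-cong (λ I → sumOver-filter (cycle? I) (cycleTerm I) (closedSeqs m)) ⟩
    sumSubsets (λ I → length (cyclesOn I) ×ᵐ cycleTerm I) ∎

  sign-product : ∀ {n} (I : Subset n) → product (λ j → Π.when (j ∈? I) (- 1#)) ≈ (- 1#) ^ ∣ I ∣
  sign-product []            = refl
  sign-product (outside ∷ I) = trans (*-identityˡ _) (sign-product I)
  sign-product (inside ∷ I)  = *-congˡ (sign-product I)

  -- At each vertex of `I` the factor `- d j * z j` separates into `- 1#`, `z j` and `d j`; the
  -- three products become the sign, the basis element and the reciprocal differences.
  cycleTerm-split : ∀ I → cycleTerm I ≈
    (- 1#) ^ ∣ I ∣ * product (λ j → Π.when (j ∈? I) (z j)) * product (λ j → Π.when (j ∈? I) (d j))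
  cycleTerm-split I = begin
    product (λ j → Π.when (j ∈? I) (- d j * z j))
      ≈⟨ Π.sum-cong (λ j → begin
           Π.when (j ∈? I) (- d j * z j)          ≈⟨ when-cong (j ∈? I) (rearrange (d j) (z j)) ⟩
           Π.when (j ∈? I) (- 1# * z j * d j)     ≈⟨ Π.when-∙ (j ∈? I) (- 1# * z j) (d j) ⟩
           Π.when (j ∈? I) (- 1# * z j) * D j     ≈⟨ *-congʳ (Π.when-∙ (j ∈? I) (- 1#) (z j)) ⟩
           S j * Z j * D j                        ∎) ⟩
    product (λ j → S j * Z j * D j)
      ≈⟨ Π.∑-distrib-+ (λ j → S j * Z j) D ⟩
    product (λ j → S j * Z j) * product D
      ≈⟨ *-congʳ (trans (Π.∑-distrib-+ S Z) (*-congʳ (sign-product I))) ⟩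
    (- 1#) ^ ∣ I ∣ * product Z * product D ∎
    where
    S Z D : Fin m → Carrier
    S j = Π.when (j ∈? I) (- 1#)
    Z j = Π.when (j ∈? I) (z j)
    D j = Π.when (j ∈? I) (d j)

    rearrange : ∀ x y → - x * y ≈ - 1# * y * x
    rearrange x y = begin
      - x * y       ≈⟨ *-congʳ (-1*x≈-x x) ⟨
      - 1# * x * y  ≈⟨ *-assoc (- 1#) x y ⟩
      - 1# * (x * y) ≈⟨ *-congˡ (*-comm x y) ⟩
      - 1# * (y * x) ≈⟨ *-assoc (- 1#) y x ⟨
      - 1# * y * x  ∎

    when-cong : ∀ {P : Set} (P? : Dec P) {x y} → x ≈ y → Π.when P? x ≈ Π.when P? y
    when-cong (yes _) x≈y = x≈y
    when-cong (no _)  x≈y = refl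

-- Integers and conjugation in the complex numbers and zeons

open import Data.Integer using (ℤ; +_; _*_; _^_; -1ℤ)
import Data.Integer as ℤ
import Data.Integer.Properties as ℤ

-- Division in `ℚ` normalises and does not compute on variables; among unnormalised rationals the
-- claim is an integer identity over denominator 1.
/1-homo-+ : ∀ i j → (i ℤ.+ j) ℚ./ 1 ≡ i ℚ./ 1 ℚ.+ j ℚ./ 1
/1-homo-+ i j = ℚ.toℚᵘ-injective (begin-equality
  ℚ.toℚᵘ ((i ℤ.+ j) ℚ./ 1)                  ≃⟨ ℚ.toℚᵘ-fromℚᵘ (ℚᵘ.mkℚᵘ (i ℤ.+ j) 0) ⟩
  ℚᵘ.mkℚᵘ (i ℤ.+ j) 0                       ≃⟨ ℚᵘ.*≡* (≡.cong (ℤ._* + 1) (≡.cong₂ ℤ._+_ (≡.sym (ℤ.*-identityʳ i)) (≡.sym (ℤ.*-identityʳ j)))) ⟩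
  ℚᵘ.mkℚᵘ i 0 ℚᵘ.+ ℚᵘ.mkℚᵘ j 0              ≃⟨ ℚᵘ.+-cong (ℚ.toℚᵘ-fromℚᵘ (ℚᵘ.mkℚᵘ i 0)) (ℚ.toℚᵘ-fromℚᵘ (ℚᵘ.mkℚᵘ j 0)) ⟨
  ℚ.toℚᵘ (i ℚ./ 1) ℚᵘ.+ ℚ.toℚᵘ (j ℚ./ 1)    ≃⟨ ℚ.toℚᵘ-homo-+ (i ℚ./ 1) (j ℚ./ 1) ⟨
  ℚ.toℚᵘ (i ℚ./ 1 ℚ.+ j ℚ./ 1)              ∎)
  where open ℚᵘ.≤-Reasoning

fromℚᶜ-+ : ∀ p q → fromℚᶜ (p ℚ.+ q) ≈ᶜ fromℚᶜ p +ᶜ fromℚᶜ q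
fromℚᶜ-+ p q = mk≈ᶜ (≈ʳ-pointwise λ _ → ≡.refl) (≈ʳ-pointwise λ _ → ≡.refl)

fromℚᶜ-* : ∀ p q → fromℚᶜ (p ℚ.* q) ≈ᶜ fromℚᶜ p *ᶜ fromℚᶜ q
fromℚᶜ-* p q = mk≈ᶜ
  (≈ʳ-pointwise λ _ → ≡.sym (ℚ.+-identityʳ (p ℚ.* q)))
  (≈ʳ-pointwise λ _ → ≡.sym (≡.cong₂ ℚ._+_ (ℚ.*-zeroʳ p) (ℚ.*-zeroˡ q)))

-- The constant sequences stay at distance 1, which a tolerance of `½` rules out.
1≉0 : ¬ ℂᵣ.1# ℂᵣ.≈ ℂᵣ.0#
1≉0 1≈0 with together (re≈ 1≈0) ½ (ℚ.positive⁻¹ ½)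
... | N , p with p N N ℕ.≤-refl ℕ.≤-refl
...   | ℚ.*<* (ℤ.+<+ (ℕ.s≤s ()))

conjᶜ-cong : ∀ {x y} → x ≈ᶜ y → conjᶜ x ≈ᶜ conjᶜ y
conjᶜ-cong x≈y = mk≈ᶜ (re≈ x≈y) (CommutativeRing.-‿cong ℝ-ring (im≈ x≈y))

conjᶜ-* : ∀ x y → conjᶜ x *ᶜ conjᶜ y ≈ᶜ conjᶜ (x *ᶜ y)
conjᶜ-* x y = mk≈ᶜ
  (≈ʳ-pointwise λ n → re-* (seq (re x) n) (seq (im x) n) (seq (re y) n) (seq (im y) n))
  (≈ʳ-pointwise λ n → im-* (seq (re x) n) (seq (im x) n) (seq (re y) n) (seq (im y) n))
  where
  open import Data.Rational.Solver using (module +-*-Solver)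
  open +-*-Solver

  re-* : ∀ a b c d → a ℚ.* c ℚ.+ ℚ.- (ℚ.- b ℚ.* ℚ.- d) ≡ a ℚ.* c ℚ.+ ℚ.- (b ℚ.* d)
  re-* = solve 4 (λ a b c d → a :* c :+ :- (:- b :* :- d) := a :* c :+ :- (b :* d)) ≡.refl

  im-* : ∀ a b c d → a ℚ.* ℚ.- d ℚ.+ ℚ.- b ℚ.* c ≡ ℚ.- (a ℚ.* d ℚ.+ b ℚ.* c)
  im-* = solve 4 (λ a b c d → a :* :- d :+ :- b :* c := :- (a :* d :+ b :* c)) ≡.refl

ℭ-conj : ∀ u → ℭ (conj u) ≈ᶜ conjᶜ (ℭ u)
ℭ-conj (scalar a) = ℂᵣ.refl
ℭ-conj (ζ i)      = mk≈ᶜ (≈ʳ-pointwise λ _ → ≡.refl) (≈ʳ-pointwise λ _ → ≡.refl)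
ℭ-conj (u ⊕ v)    = ℂᵣ.trans (ℂᵣ.+-cong (ℭ-conj u) (ℭ-conj v))
  (mk≈ᶜ (≈ʳ-pointwise λ _ → ≡.refl)
        (≈ʳ-pointwise λ n → ≡.sym (ℚ.neg-distrib-+ (seq (im (ℭ u)) n) (seq (im (ℭ v)) n))))
ℭ-conj (u ⊗ v)    = ℂᵣ.trans (ℂᵣ.*-cong (ℭ-conj u) (ℭ-conj v)) (conjᶜ-* (ℭ u) (ℭ v))
ℭ-conj (⊖ u)      = ℂᵣ.trans (ℂᵣ.-‿cong (ℭ-conj u)) (mk≈ᶜ (≈ʳ-pointwise λ _ → ≡.refl) (≈ʳ-pointwise λ _ → ≡.refl))

ι : ℤ → Zeon
ι i = scalar (fromℤᶜ i)

ι-+ : ∀ i j → ι (i ℤ.+ j) ≈ᶻ ι i ⊕ ι j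
ι-+ i j = transᶻ
  (scalar-cong (ℂᵣ.trans (ℂᵣ.reflexive (≡.cong fromℚᶜ (/1-homo-+ i j))) (fromℚᶜ-+ (i ℚ./ 1) (j ℚ./ 1))))
  (scalar-+ (fromℤᶜ i) (fromℤᶜ j))

module _ where
  open import Algebra.Properties.Ring Zᵣ.ring
  open import Algebra.Definitions.RawMonoid Zᵣ.+-rawMonoid using () renaming (_×_ to infixr 8 _×ᵐ_)
  open import Relation.Binary.Reasoning.Setoid Zᵣ.setoid

  ι-neg : ∀ i → ι (ℤ.- i) ≈ᶻ ⊖ ι i
  ι-neg i = +-inverseˡ-unique (ι (ℤ.- i)) (ι i) (transᶻ (symᶻ (ι-+ (ℤ.- i) i))
    (Zᵣ.reflexive (≡.cong ι (ℤ.+-inverseˡ i))))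

  ι-× : ∀ n u → ι (+ n) ⊗ u ≈ᶻ n ×ᵐ u
  ι-× zero    u = Zᵣ.zeroˡ u
  ι-× (suc n) u = transᶻ (⊗-cong (ι-+ (+ 1) (+ n)) reflᶻ)
    (transᶻ (Zᵣ.distribʳ u _ _) (⊕-cong (⊗-identityˡ u) (ι-× n u)))

  ι-sign : ∀ k i → ι (-1ℤ ^ k * i) ≈ᶻ (⊖ Zᵣ.1#) ZeonOps.^ k ⊗ ι i
  ι-sign zero    i = transᶻ (Zᵣ.reflexive (≡.cong ι (ℤ.*-identityˡ i))) (symᶻ (⊗-identityˡ (ι i)))
  ι-sign (suc k) i = begin
    ι (-1ℤ * -1ℤ ^ k * i)                        ≡⟨ ≡.cong ι (≡.trans (ℤ.*-assoc -1ℤ (-1ℤ ^ k) i) (ℤ.-1*i≡-i _)) ⟩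
    ι (ℤ.- (-1ℤ ^ k * i))                        ≈⟨ ι-neg (-1ℤ ^ k * i) ⟩
    ⊖ ι (-1ℤ ^ k * i)                            ≈⟨ ⊖-cong (ι-sign k i) ⟩
    ⊖ ((⊖ Zᵣ.1#) ZeonOps.^ k ⊗ ι i)              ≈⟨ -1*x≈-x _ ⟨
    ⊖ Zᵣ.1# ⊗ ((⊖ Zᵣ.1#) ZeonOps.^ k ⊗ ι i)      ≈⟨ ⊗-assoc _ _ _ ⟨
    ⊖ Zᵣ.1# ⊗ (⊖ Zᵣ.1#) ZeonOps.^ k ⊗ ι i        ∎

-- Since `(-1)^(2k) = 1`, defining `ω` as the sign times the count gives back the count when
-- multiplied by the sign again.
sign-involutive : ∀ k i → -1ℤ ^ k * (-1ℤ ^ k * i) ≡ i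
sign-involutive k i = begin
  -1ℤ ^ k * (-1ℤ ^ k * i)      ≡⟨ ℤ.*-assoc (-1ℤ ^ k) (-1ℤ ^ k) i ⟨
  -1ℤ ^ k * -1ℤ ^ k * i        ≡⟨ ≡.cong (_* i) (ℤ.^-distribˡ-+-* -1ℤ k k) ⟨
  -1ℤ ^ (k ℕ.+ k) * i          ≡⟨ ≡.cong (λ n → -1ℤ ^ (k ℕ.+ n) * i) (ℕ.+-identityʳ k) ⟨
  -1ℤ ^ (2 ℕ.* k) * i          ≡⟨ ≡.cong (_* i) (ℤ.^-*-assoc -1ℤ 2 k) ⟨
  (-1ℤ ^ 2) ^ k * i            ≡⟨ ≡.cong (_* i) (ℤ.^-zeroˡ k) ⟩
  + 1 * i                      ≡⟨ ℤ.*-identityˡ i ⟩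
  i                            ∎
  where open ≡.≡-Reasoning

-- Products over a subset and the reciprocal differences

module ProductsOver (R : CommutativeRing 0ℓ 0ℓ) where
  open CommutativeRing R hiding (zero)
  open RingOps rawRing
  open MonoidSums *-commutativeMonoid using (sum-cong)
  open MonoidImages *-commutativeMonoid using (when)

  -- As for charPoly-matrix, the witness names a function local to productOver.
  productOver-factors : ∀ {m} (I : Subset m) (F : ∀ j → j ∈ I → Carrier) →
    ∃ λ (t : Fin m → Carrier) → productOver I F ≡ product t
  productOver-factors I F = _ , ≡.refl

  productOver-when : ∀ {m} (I : Subset m) (F : ∀ j → j ∈ I → Carrier) (x : Fin m → Carrier) →
    (∀ j j∈I → F j j∈I ≈ x j) → productOver I F ≈ product (λ j → when (j ∈? I) (x j))
  productOver-when I F x F≈x = sum-cong factor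
    where
    factor : ∀ j → proj₁ (productOver-factors I F) j ≈ when (j ∈? I) (x j)
    factor j with j ∈? I
    ... | yes j∈I = F≈x j j∈I
    ... | no  _   = refl

ζ[]-product : ∀ {m} (I : Subset m) →
  let open MonoidImages Zᵣ.*-commutativeMonoid in
  ζ[ I ] ≈ᶻ ZeonOps.product λ j → when (j ∈? I) (ζ (suc (toℕ j)))
ζ[]-product I = ProductsOver.productOver-when Zeon-ring I _ (λ j → ζ (suc (toℕ j))) (λ _ _ → reflᶻ)

scalar-product : ∀ {n} (t : Fin n → ℂ) → scalar (ℂOps.product t) ≈ᶻ ZeonOps.product (scalar ∘ t)
scalar-product {zero}  t = reflᶻ
scalar-product {suc n} t = transᶻ (scalar-* _ _) (⊗-cong reflᶻ (scalar-product (t ∘ suc)))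

x∉p-x : ∀ {m} (p : Subset m) x → ¬ x ∈ p Subset.- x
x∉p-x (_ ∷ p) zero    ()
x∉p-x (_ ∷ p) (suc x) (there x∈) = x∉p-x p x x∈

module Reciprocals {m} (f : Fin m → ℕ) (f-inj : Injective _≡_ _≡_ f) (ℓ : Fin m) where
  reciprocal-aux : ∀ {j} → Dec (j ≡ ℓ) → ℂ
  reciprocal-aux (yes _) = ℂᵣ.1#
  reciprocal-aux {j} (no j≢ℓ) = inverseDifference (f ℓ) (f j) (j≢ℓ ∘ ≡.sym ∘ f-inj)

  reciprocal : Fin m → ℂ
  reciprocal j = reciprocal-aux (j ≟ ℓ)

  reciprocal-ℓ : reciprocal ℓ ≡ ℂᵣ.1#
  reciprocal-ℓ with ℓ ≟ ℓ
  ... | yes _  = ≡.refl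
  ... | no ℓ≢ℓ = contradiction ≡.refl ℓ≢ℓ

  -- The proof of inequality is arbitrary because reciprocals in `ℚ` take their nonzero proof
  -- irrelevantly. The value therefore agrees with the factor in `coefficient`, whose proof is built
  -- differently.
  reciprocal-off : ∀ {j} → j ≢ ℓ → (fℓ≢fj : f ℓ ≢ f j) → reciprocal j ≡ inverseDifference (f ℓ) (f j) fℓ≢fj
  reciprocal-off {j} j≢ℓ _ with j ≟ ℓ
  ... | yes j≡ℓ = contradiction j≡ℓ j≢ℓ
  ... | no _    = ≡.refl

  reciprocal-inverse : ∀ i → i ≢ ℓ → scalar (reciprocal i) ⊗ (ι (+ f ℓ) Zᵣ.- ι (+ f i)) ≈ᶻ Zᵣ.1#
  reciprocal-inverse i i≢ℓ = begin
    scalar (reciprocal i) ⊗ (ι (+ f ℓ) Zᵣ.- ι (+ f i))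
      ≈⟨ ⊗-cong (Zᵣ.reflexive (≡.cong scalar (reciprocal-off i≢ℓ fℓ≢fi)))
                (symᶻ (transᶻ (ι-+ (+ f ℓ) (ℤ.- + f i)) (⊕-cong reflᶻ (ι-neg (+ f i))))) ⟩
    scalar (fromℚᶜ (ℚ.1/ q)) ⊗ scalar (fromℚᶜ q)
      ≈⟨ scalar-* (fromℚᶜ (ℚ.1/ q)) (fromℚᶜ q) ⟨
    scalar (fromℚᶜ (ℚ.1/ q) *ᶜ fromℚᶜ q)
      ≈⟨ scalar-cong (fromℚᶜ-* (ℚ.1/ q) q) ⟨
    scalar (fromℚᶜ (ℚ.1/ q ℚ.* q))
      ≡⟨ ≡.cong (scalar ∘ fromℚᶜ) (ℚ.*-inverseˡ q) ⟩
    Zᵣ.1# ∎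
    where
    open import Relation.Binary.Reasoning.Setoid Zᵣ.setoid

    fℓ≢fi : f ℓ ≢ f i
    fℓ≢fi = i≢ℓ ∘ ≡.sym ∘ f-inj

    q : ℚ
    q = difference (f ℓ) (f i)

    instance
      q-nonZero : ℚ.NonZero q
      q-nonZero = ℚ.≢-nonZero (difference≢0 fℓ≢fi)

  private
    module ℂΠ where
      open MonoidSums ℂᵣ.*-commutativeMonoid public
      open MonoidImages ℂᵣ.*-commutativeMonoid public
    module ZΠ where
      open MonoidSums Zᵣ.*-commutativeMonoid public
      open MonoidImages Zᵣ.*-commutativeMonoid public

  -- The two index sets differ at most in `ℓ`, where `reciprocal` is `1#`.
  coefficient-product : ∀ I →
    coefficient f f-inj ℓ I ≈ᶜ ℂOps.product λ j → ℂΠ.when (j ∈? I) (reciprocal j)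
  coefficient-product I = ℂᵣ.trans
    (ProductsOver.productOver-when ℂ-ring (I Subset.- ℓ) (λ j j∈ → inverseDifference (f ℓ) (f j) (fℓ≢f j∈)) reciprocal
      λ j j∈ → ℂᵣ.reflexive (≡.sym (reciprocal-off (∈⇒≢ℓ j∈) (fℓ≢f j∈))))
    (ℂΠ.sum-cong λ j → restore j (j ≟ ℓ))
    where
    ∈⇒≢ℓ : ∀ {j} → j ∈ I Subset.- ℓ → j ≢ ℓ
    ∈⇒≢ℓ j∈ ≡.refl = x∉p-x I ℓ j∈

    fℓ≢f : ∀ {j} → j ∈ I Subset.- ℓ → f ℓ ≢ f j
    fℓ≢f j∈ = ∈⇒≢ℓ j∈ ∘ ≡.sym ∘ f-inj

    when-1 : ∀ {P : Set} (P? : Dec P) → ℂΠ.when P? ℂᵣ.1# ≈ᶜ ℂᵣ.1#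
    when-1 (yes _) = ℂᵣ.refl
    when-1 (no _)  = ℂᵣ.refl

    restore : ∀ j → Dec (j ≡ ℓ) →
      ℂΠ.when (j ∈? (I Subset.- ℓ)) (reciprocal j) ≈ᶜ ℂΠ.when (j ∈? I) (reciprocal j)
    restore j (yes ≡.refl) rewrite reciprocal-ℓ =
      ℂᵣ.trans (when-1 (j ∈? (I Subset.- ℓ))) (ℂᵣ.sym (when-1 (j ∈? I)))
    restore j (no j≢ℓ) = restore′ (j ∈? I)
      where
      restore′ : Dec (j ∈ I) → ℂΠ.when (j ∈? (I Subset.- ℓ)) (reciprocal j) ≈ᶜ ℂΠ.when (j ∈? I) (reciprocal j)
      restore′ (yes j∈I) = ℂᵣ.trans (ℂΠ.when-yes (j ∈? (I Subset.- ℓ)) (x∈p∧x≢y⇒x∈p-y j∈I j≢ℓ))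
        (ℂᵣ.sym (ℂΠ.when-yes (j ∈? I) j∈I))
      restore′ (no j∉I)  = ℂᵣ.trans (ℂΠ.when-no (j ∈? (I Subset.- ℓ)) (j∉I ∘ p─q⊆p I _))
        (ℂᵣ.sym (ℂΠ.when-no (j ∈? I) j∉I))

  scalar-coefficient : ∀ I →
    scalar (coefficient f f-inj ℓ I) ≈ᶻ ZeonOps.product λ j → ZΠ.when (j ∈? I) (scalar (reciprocal j))
  scalar-coefficient I = transᶻ (scalar-cong (coefficient-product I)) (transᶻ
    (scalar-product (λ j → ℂΠ.when (j ∈? I) (reciprocal j))) (ZΠ.sum-cong λ j → scalar-when (j ∈? I)))
    where
    scalar-when : ∀ {P : Set} (P? : Dec P) {x} → scalar (ℂΠ.when P? x) ≈ᶻ ZΠ.when P? (scalar x)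
    scalar-when (yes _) = reflᶻ
    scalar-when (no _)  = reflᶻ

-- Scalar parts of polynomials

module ZP = PolynomialRoots Zeon-ring
module CP = PolynomialRoots ℂ-ring

-- `ℭ` recurses on terms, so it commutes with evaluation by computation, and then with `quotient`
-- too. Hence a single fact about the scalar part of the derivative settles both conditions of
-- spectral simplicity.
ℭ-eval : ∀ p u → ℂPoly.eval (map ℭ p) (ℭ u) ≡ ℭ (ZeonPoly.eval p u)
ℭ-eval []      u = ≡.refl
ℭ-eval (c ∷ p) u = ≡.cong (λ x → ℭ c +ᶜ ℭ u *ᶜ x) (ℭ-eval p u)

ℭ-quotient : ∀ p u → CP.quotient (map ℭ p) (ℭ u) ≡ map ℭ (ZP.quotient p u)
ℭ-quotient []      u = ≡.refl
ℭ-quotient (c ∷ p) u = ≡.cong₂ _∷_ (ℭ-eval p u) (ℭ-quotient p u)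

ℭ-derivative : ∀ p u → CP.derivative (ℭ u) (map ℭ p) ≡ ℭ (ZP.derivative u p)
ℭ-derivative p u = ≡.trans (≡.cong (λ q → ℂPoly.eval q (ℭ u)) (ℭ-quotient p u)) (ℭ-eval (ZP.quotient p u) u)

unit≉0 : ∀ {x} → (∃ λ v → v *ᶜ x ≈ᶜ ℂᵣ.1#) → ¬ x ≈ᶜ ℂᵣ.0#
unit≉0 (v , vx≈1) x≈0 = 1≉0 (ℂᵣ.trans (ℂᵣ.sym vx≈1) (ℂᵣ.trans (ℂᵣ.*-cong ℂᵣ.refl x≈0) (ℂᵣ.zeroʳ v)))

-- The eigenvalue of the labeled Laplacian

module Laplacian {m} (G : SimpleGraph m) (f : Fin m → ℕ) (f-inj : Injective _≡_ _≡_ f) (ℓ : Fin m) where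
  open Reciprocals f f-inj ℓ
  open CycleWeights Zeon-ring G ℓ (λ j → ζ (suc (toℕ j))) (λ j → ζ²≈0 (suc (toℕ j)))
    (scalar ∘ reciprocal) (Zᵣ.reflexive (≡.cong scalar (reciprocal-ℓ)))
  open Cycles G ℓ
  open MonoidSums Zᵣ.+-commutativeMonoid using (sum-cong; sum-single; ∑-distrib-+)
  open MonoidImages Zᵣ.+-commutativeMonoid using (when; when-yes; when-no)
  open import Algebra.Properties.Ring Zᵣ.ring
  open import Algebra.Properties.Semiring.Sum Zᵣ.semiring using (*-distribˡ-sum)
  module Dual = DualNumbers ZeonPoly.polyRawRing ℂ-ring
  open Dual using (Unit; Unit-cong)

  Λ : Matrix Zeon m
  Λ = laplacian G f

  φ : Fin m → Zeon
  φ i = ι (+ f i)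

  μ : Zeon
  μ = φ ℓ ⊕ Q m ℓ

  Δ-on : ∀ i → Δ f i i ≈ᶻ φ i
  Δ-on i with i ≟ i
  ... | yes _  = reflᶻ
  ... | no i≢i = contradiction ≡.refl i≢i

  Δ-off : ∀ {i j} → i ≢ j → Δ f i j ≈ᶻ Zᵣ.0#
  Δ-off {i} {j} i≢j with i ≟ j
  ... | yes i≡j = contradiction i≡j i≢j
  ... | no _    = reflᶻ

  Ψ≈ψ : ∀ i j → Ψ G i j ≈ᶻ ψ i j
  Ψ≈ψ i j with adj? G i j
  ... | yes _ = symᶻ (Zᵣ.*-identityʳ _)
  ... | no _  = symᶻ (Zᵣ.zeroʳ _)

  Λ-eigen : ∀ i → ZeonOps.sum (λ j → Λ i j ⊗ y j) ≈ᶻ μ ⊗ y i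
  Λ-eigen i = begin
    ZeonOps.sum (λ j → Λ i j ⊗ y j)
      ≈⟨ sum-cong (λ j → Zᵣ.trans (Zᵣ.distribʳ (y j) (Δ f i j) (⊖ Ψ G i j)) (⊕-cong reflᶻ (negate j))) ⟩
    ZeonOps.sum (λ j → Δ f i j ⊗ y j ⊕ ⊖ Zᵣ.1# ⊗ (ψ i j ⊗ y j))
      ≈⟨ ∑-distrib-+ (λ j → Δ f i j ⊗ y j) (λ j → ⊖ Zᵣ.1# ⊗ (ψ i j ⊗ y j)) ⟩
    ZeonOps.sum (λ j → Δ f i j ⊗ y j) ⊕ ZeonOps.sum (λ j → ⊖ Zᵣ.1# ⊗ (ψ i j ⊗ y j))
      ≈⟨ ⊕-cong
           (transᶻ (sum-single (λ j → Δ f i j ⊗ y j) i λ j j≢i →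
               transᶻ (⊗-cong (Δ-off (j≢i ∘ ≡.sym)) reflᶻ) (Zᵣ.zeroˡ (y j)))
             (⊗-cong (Δ-on i) reflᶻ))
           (transᶻ (symᶻ (*-distribˡ-sum (⊖ Zᵣ.1#) (λ j → ψ i j ⊗ y j))) (-1*x≈-x _)) ⟩
    φ i ⊗ y i Zᵣ.- ZeonOps.sum (λ j → ψ i j ⊗ y j)
      ≈⟨ y-eigen φ (reciprocal-inverse) i ⟩
    μ ⊗ y i ∎
    where
    open import Relation.Binary.Reasoning.Setoid Zᵣ.setoid

    negate : ∀ j → ⊖ Ψ G i j ⊗ y j ≈ᶻ ⊖ Zᵣ.1# ⊗ (ψ i j ⊗ y j)
    negate j = begin
      ⊖ Ψ G i j ⊗ y j             ≈⟨ ⊗-cong (⊖-cong (Ψ≈ψ i j)) reflᶻ ⟩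
      ⊖ ψ i j ⊗ y j               ≈⟨ -‿distribˡ-* (ψ i j) (y j) ⟨
      ⊖ (ψ i j ⊗ y j)             ≈⟨ -1*x≈-x _ ⟨
      ⊖ Zᵣ.1# ⊗ (ψ i j ⊗ y j)     ∎

  ℭ-Multiple : ∀ {u} → Multiple u → ℭ u ≈ᶜ ℂᵣ.0#
  ℭ-Multiple (r , u≈) = ℂᵣ.trans (ℭ-cong u≈) (ℂᵣ.zeroˡ (ℭ r))

  ℭyℓ≈1 : ℭ (y ℓ) ≈ᶜ ℂᵣ.1#
  ℭyℓ≈1 = ℂᵣ.trans (ℭ-cong yℓ≈)
    (ℂᵣ.trans (ℂᵣ.+-cong ℂᵣ.refl (ℭ-Multiple (Q-Multiple m ℓ))) (ℂᵣ.+-identityʳ ℂᵣ.1#))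

  ℭ-sum : ∀ {n} (t : Fin n → Zeon) → ℭ (ZeonOps.sum t) ≈ᶜ ℂOps.sum (ℭ ∘ t)
  ℭ-sum {zero}  t = ℂᵣ.refl
  ℭ-sum {suc n} t = ℂᵣ.+-cong ℂᵣ.refl (ℭ-sum (t ∘ suc))

  -- Away from `ℓ` the components of `y` are multiples of the generator at `ℓ` and have scalar part
  -- zero, so the norm has the scalar part of the component at `ℓ` alone, which is 1.
  y-NonNull : NonNull y
  y-NonNull norm≈0 = 1≉0 (ℂᵣ.trans (ℂᵣ.sym norm≈1) norm≈0)
    where
    open import Relation.Binary.Reasoning.Setoid ℂᵣ.setoid
    module ℂΣ = MonoidSums ℂᵣ.+-commutativeMonoid

    norm : Fin m → Zeon
    norm i = conj (y i) ⊗ y i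

    norm≈1 : ℭ (ZeonOps.sum norm) ≈ᶜ ℂᵣ.1#
    norm≈1 = begin
      ℭ (ZeonOps.sum norm)         ≈⟨ ℭ-sum norm ⟩
      ℂOps.sum (ℭ ∘ norm)          ≈⟨ ℂΣ.sum-single (ℭ ∘ norm) ℓ (λ i i≢ℓ →
                                        ℂᵣ.trans (ℂᵣ.*-cong ℂᵣ.refl (ℂᵣ.trans (ℭ-cong (y-off i i≢ℓ)) (ℭ-Multiple (Q-Multiple m i))))
                                                 (ℂᵣ.zeroʳ _)) ⟩
      ℭ (conj (y ℓ)) *ᶜ ℭ (y ℓ)    ≈⟨ ℂᵣ.*-cong (ℂᵣ.trans (ℭ-conj (y ℓ)) (conjᶜ-cong ℭyℓ≈1)) ℭyℓ≈1 ⟩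
      conjᶜ ℂᵣ.1# *ᶜ ℂᵣ.1#         ≈⟨ ℂᵣ.*-identityʳ _ ⟩
      conjᶜ ℂᵣ.1#                  ≈⟨ mk≈ᶜ (≈ʳ-pointwise λ _ → ≡.refl) (≈ʳ-pointwise λ _ → ≡.refl) ⟩
      ℂᵣ.1#                        ∎

  χ : ZeonPoly.Poly
  χ = ZeonPoly.charPoly Λ

  -- `y ℓ` annihilates the value of `χ` and is `1 + q` with `q` of square zero, so `1 - q` is its
  -- exact inverse and cancels it.
  χ-root : ZeonPoly.eval χ μ ≈ᶻ Zᵣ.0#
  χ-root = begin
    ZeonPoly.eval χ μ
      ≈⟨ ⊗-identityˡ _ ⟨
    Zᵣ.1# ⊗ ZeonPoly.eval χ μ
      ≈⟨ ⊗-cong inverse reflᶻ ⟨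
    (Zᵣ.1# Zᵣ.- q) ⊗ y ℓ ⊗ ZeonPoly.eval χ μ
      ≈⟨ transᶻ (⊗-assoc _ _ _) (⊗-cong reflᶻ (ZP.eigenvector-annihilates Λ μ y Λ-eigen ℓ)) ⟩
    (Zᵣ.1# Zᵣ.- q) ⊗ Zᵣ.0#
      ≈⟨ Zᵣ.zeroʳ _ ⟩
    Zᵣ.0# ∎
    where
    open import Relation.Binary.Reasoning.Setoid Zᵣ.setoid

    q : Zeon
    q = Q m ℓ

    inverse : (Zᵣ.1# Zᵣ.- q) ⊗ y ℓ ≈ᶻ Zᵣ.1#
    inverse = begin
      (Zᵣ.1# Zᵣ.- q) ⊗ y ℓ
        ≈⟨ transᶻ (⊗-cong reflᶻ yℓ≈) (Zᵣ.distribʳ (Zᵣ.1# ⊕ q) Zᵣ.1# (⊖ q)) ⟩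
      Zᵣ.1# ⊗ (Zᵣ.1# ⊕ q) ⊕ ⊖ q ⊗ (Zᵣ.1# ⊕ q)
        ≈⟨ ⊕-cong (⊗-identityˡ _) (transᶻ (symᶻ (-‿distribˡ-* q (Zᵣ.1# ⊕ q)))
             (⊖-cong (transᶻ (⊗-distribˡ q Zᵣ.1# q) (transᶻ
               (⊕-cong (Zᵣ.*-identityʳ q) (Multiple-orthogonal (Q-Multiple m ℓ) (Q-Multiple m ℓ))) (Zᵣ.+-identityʳ q))))) ⟩
      Zᵣ.1# ⊕ q ⊕ ⊖ q
        ≈⟨ transᶻ (⊕-assoc _ _ _) (transᶻ (⊕-cong reflᶻ (Zᵣ.-‿inverseʳ q)) (Zᵣ.+-identityʳ _)) ⟩
      Zᵣ.1# ∎

  -- Evaluation at `μ` followed by the scalar part. The second map is what makes the characteristic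
  -- matrix diagonal, as every entry of `Ψ` has scalar part zero.
  h : Dual.Homomorphism
  h = record
    { ⟦_⟧     = λ p → ℭ (ZeonPoly.eval p μ)
    ; 0-homo  = ℂᵣ.refl
    ; 1-homo  = ℭ-cong (ZP.eval-const Zᵣ.1# μ)
    ; -1-homo = ℭ-cong (ZP.eval-const (⊖ Zᵣ.1#) μ)
    ; +-homo  = λ p q → ℭ-cong (ZP.eval-+ₚ p q μ)
    ; *-homo  = λ p q → ℭ-cong (ZP.eval-*ₚ p q μ)
    }

  ∂-const : ∀ c → ZP.derivative μ (ZeonPoly.const c) ≈ᶻ Zᵣ.0#
  ∂-const c = ZP.eval-const Zᵣ.0# μ

  ∂-linear : ∀ c → ZP.derivative μ (c ∷ Zᵣ.1# ∷ []) ≈ᶻ Zᵣ.1#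
  ∂-linear c = transᶻ (⊕-cong (ZP.eval-const Zᵣ.1# μ) (transᶻ (⊗-cong reflᶻ (∂-const Zᵣ.1#)) (Zᵣ.zeroʳ μ)))
    (Zᵣ.+-identityʳ Zᵣ.1#)

  ∂ : Dual.Derivation h
  ∂ = record
    { ∂   = ℭ ∘ ZP.derivative μ
    ; ∂-0 = ℂᵣ.refl
    ; ∂-1 = ℭ-cong (∂-const Zᵣ.1#)
    ; ∂-+ = λ p q → ℭ-cong (ZP.derivative-+ₚ μ p q)
    ; ∂-* = λ p q → ℭ-cong (ZP.derivative-*ₚ μ p q)
    }

  ℭμ : ℭ μ ≈ᶜ ℭ (φ ℓ)
  ℭμ = ℂᵣ.trans (ℂᵣ.+-cong ℂᵣ.refl (ℭ-Multiple (Q-Multiple m ℓ))) (ℂᵣ.+-identityʳ _)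

  ℭΨ : ∀ i j → ℭ (Ψ G i j) ≈ᶜ ℂᵣ.0#
  ℭΨ i j with adj? G i j
  ... | yes _ = ℂᵣ.refl
  ... | no _  = ℂᵣ.refl

  ℭΛ-off : ∀ {i j} → i ≢ j → ℭ (Λ i j) ≈ᶜ ℂᵣ.0#
  ℭΛ-off {i} {j} i≢j = ℂᵣ.trans (ℂᵣ.+-cong (ℭ-cong (Δ-off i≢j)) (ℂᵣ.-‿cong (ℭΨ i j))) (ℂᵣ.-‿inverseʳ ℂᵣ.0#)

  ℭΛ-on : ∀ i → ℭ (Λ i i) ≈ᶜ ℭ (φ i)
  ℭΛ-on i = ℂᵣ.trans (ℂᵣ.+-cong (ℭ-cong (Δ-on i)) (ℂᵣ.-‿cong (ℭΨ i i)))
    (ℂᵣ.trans (ℂᵣ.+-cong ℂᵣ.refl (ℂᵣ.trans (ℂᵣ.sym (ℂᵣ.+-identityʳ _)) (ℂᵣ.-‿inverseˡ ℂᵣ.0#)))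
              (ℂᵣ.+-identityʳ _))

  P : Matrix ZeonPoly.Poly m
  P = ZP.charPoly-entry Λ

  P-on : ∀ i → ℭ (ZeonPoly.eval (P i i) μ) ≈ᶜ ℭ (φ ℓ) ℂᵣ.- ℭ (φ i)
  P-on i = ℂᵣ.trans (ℭ-cong (ZP.charPoly-value Λ μ i i))
    (ℂᵣ.+-cong (ℂᵣ.trans (ℭ-cong (when-yes (i ≟ i) ≡.refl)) ℭμ) (ℂᵣ.-‿cong (ℭΛ-on i)))

  P-diagonal : Dual.Derivation.Diagonal ∂ P
  P-diagonal = record
    { value = λ i j i≢j → ℂᵣ.trans
        (ℭ-cong (transᶻ (ZP.charPoly-value Λ μ i j)
          (transᶻ (⊕-cong (when-no (i ≟ j) i≢j) reflᶻ) (⊕-identityˡ (⊖ Λ i j)))))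
        (ℂᵣ.trans (ℂᵣ.-‿cong (ℭΛ-off i≢j)) (ℂᵣ.trans (ℂᵣ.sym (ℂᵣ.+-identityʳ _)) (ℂᵣ.-‿inverseˡ ℂᵣ.0#)))
    ; slope = λ i j i≢j → slope i≢j (ZP.entry Λ i j)
    }
    where
    slope : ∀ {i j p} → i ≢ j → ZP.Entry Λ i j p → ℭ (ZP.derivative μ p) ≈ᶜ ℂᵣ.0#
    slope i≢j ZP.on      = contradiction ≡.refl i≢j
    slope {i} {j} i≢j (ZP.off _) = ℭ-cong (∂-const (⊖ Λ i j))

  ∂χ-unit : Unit (ℭ (ZP.derivative μ χ))
  ∂χ-unit = Dual.Derivation.slope-det-unit ∂ P-diagonal ℓ
    (ℂᵣ.trans (P-on ℓ) (ℂᵣ.-‿inverseʳ _))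
    (Unit-cong (ℂᵣ.sym (slope (ZP.entry Λ ℓ ℓ))) Dual.Unit-1)
    (λ i i≢ℓ → Unit-cong (ℂᵣ.sym (P-on i))
      -- The scalar entry is `f ℓ - f i`, and its inverse is the same `d i` that built the
      -- eigenvector.
      (reciprocal i , ℭ-cong (reciprocal-inverse i i≢ℓ)))
    where
    slope : ∀ {p} → ZP.Entry Λ ℓ ℓ p → ℭ (ZP.derivative μ p) ≈ᶜ ℂᵣ.1#
    slope ZP.on        = ℭ-cong (∂-linear (Zᵣ.0# ⊕ ⊖ Λ ℓ ℓ))
    slope (ZP.off ℓ≢ℓ) = contradiction ≡.refl ℓ≢ℓ

  ∂χ≉0 : ¬ ℭ (ZP.derivative μ χ) ≈ᶜ ℂᵣ.0#
  ∂χ≉0 = unit≉0 ∂χ-unit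

  spectrally-simple : IsSpectrallySimpleEigenvalue Λ μ
  spectrally-simple =
    (y , y-NonNull , Λ-eigen) ,
    (ZP.quotient χ μ , ZP.factor-theorem μ χ χ-root , λ ∂χ≈0 → ∂χ≉0 (ℭ-cong ∂χ≈0)) ,
    (CP.quotient (map ℭ χ) (ℭ μ) ,
     CP.factor-theorem (ℭ μ) (map ℭ χ) (ℂᵣ.trans (ℂᵣ.reflexive (ℭ-eval χ μ)) (ℭ-cong χ-root)) ,
     λ ∂χ≈0 → ∂χ≉0 (ℂᵣ.trans (ℂᵣ.reflexive (≡.sym (ℭ-derivative χ μ))) ∂χ≈0))

  ω : Subset m → ℤ
  ω I = -1ℤ ^ ∣ I ∣ * + length (cyclesOn I)

  ω-sign : ∀ I → -1ℤ ^ ∣ I ∣ * ω I ≡ + length (cyclesOn I)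
  ω-sign I = sign-involutive ∣ I ∣ (+ length (cyclesOn I))

  open import Algebra.Definitions.RawMonoid Zᵣ.+-rawMonoid using () renaming (_×_ to infixr 8 _×ᵐ_)

  ω-term : ∀ I → length (cyclesOn I) ×ᵐ cycleTerm I ≈ᶻ
    scalar (fromℤᶜ (ω I)) ⊗ ζ[ I ] ⊗ scalar (coefficient f f-inj ℓ I)
  ω-term I = begin
    n ×ᵐ cycleTerm I
      ≈⟨ ι-× n (cycleTerm I) ⟨
    ι (+ n) ⊗ cycleTerm I
      ≈⟨ ⊗-cong reflᶻ (cycleTerm-split I) ⟩
    ι (+ n) ⊗ (sign ⊗ _ ⊗ _)
      ≈⟨ ⊗-cong reflᶻ (⊗-cong (⊗-cong reflᶻ (ζ[]-product I)) (scalar-coefficient I)) ⟨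
    ι (+ n) ⊗ (sign ⊗ ζ[ I ] ⊗ scalar (coefficient f f-inj ℓ I))
      ≈⟨ ⊗-assoc _ _ _ ⟨
    ι (+ n) ⊗ (sign ⊗ ζ[ I ]) ⊗ scalar (coefficient f f-inj ℓ I)
      ≈⟨ ⊗-cong (⊗-assoc _ _ _) reflᶻ ⟨
    ι (+ n) ⊗ sign ⊗ ζ[ I ] ⊗ scalar (coefficient f f-inj ℓ I)
      ≈⟨ ⊗-cong (⊗-cong (transᶻ (ι-sign ∣ I ∣ (+ n)) (⊗-comm sign (ι (+ n)))) reflᶻ) reflᶻ ⟨
    ι (ω I) ⊗ ζ[ I ] ⊗ scalar (coefficient f f-inj ℓ I) ∎
    where
    open import Relation.Binary.Reasoning.Setoid Zᵣ.setoid
    n : ℕ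
    n = length (cyclesOn I)

    sign : Zeon
    sign = (⊖ Zᵣ.1#) ZeonOps.^ ∣ I ∣

  μ-expansion : μ ≈ᶻ scalar (fromℤᶜ (+ f ℓ))
    ⊕ ZeonOps.sumSubsets (λ I → scalar (fromℤᶜ (ω I)) ⊗ ζ[ I ] ⊗ scalar (coefficient f f-inj ℓ I))
  μ-expansion = ⊕-cong reflᶻ (transᶻ Q-cycles (SubsetSums.sumSubsets-cong Zeon-ring ω-term))

corollary4p1 : ∀ {m : ℕ} (G : SimpleGraph m)
    (f : Fin m → ℕ) (f-pos : ∀ i → NonZero (f i)) (f-inj : Injective _≡_ _≡_ f)
    (ℓ : Fin m) →
    ∃ λ (ω : Subset m → ℤ) → ∃ λ (μ : Zeon) →
    (∀ I → ∃ λ (n : ℕ) → HasCount (IsCycleOn G ℓ I) n × (-1ℤ ^ ∣ I ∣) * ω I ≡ + n) ×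
    IsSpectrallySimpleEigenvalue (laplacian G f) μ ×
    μ ≈ᶻ scalar (fromℤᶜ (+ f ℓ))
    ⊕ ZeonOps.sumSubsets (λ I → scalar (fromℤᶜ (ω I)) ⊗ ζ[ I ] ⊗ scalar (coefficient f f-inj ℓ I))
corollary4p1 G f f-pos f-inj ℓ =
  ω , μ , (λ I → length (cyclesOn I) , cyclesOn-count I , ω-sign I) , spectrally-simple , μ-expansion
  where
  open Laplacian G f f-inj ℓ
  open Cycles G ℓ
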